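{- (i) Let $m\ge1$, let $a_1,\ldots,a_m$ be integers and $n>0$ an integer. Then, for either choice of sign, $$\sum_{k=0}^{n-1}(\pm1)^k(2k+1)\prod_{i=1}^m\binom{a_in-1}k\equiv0\pmod n,\qquad \sum_{k=0}^{n-1}(\pm1)^k(4k^3-1)\prod_{i=1}^m\binom{a_in-1}k\equiv0\pmod n.$$ Also $$\gcd(a_1+\cdots+a_m-1,2)\sum_{k=0}^{n-1}(-1)^{km}(2k+1)\prod_{i=1}^m\binom{a_in-1}k\equiv0\pmod {n^2},$$ $$6\sum_{k=0}^{n-1}(-1)^{km}(3k^2+3k+1)\prod_{i=1}^m\binom{a_in-1}k\equiv0\pmod {n^2},$$ $$\sum_{k=0}^{n-1}(-1)^k(4k^3-1)\prod_{i=1}^m\binom{a_in-1}k\binom{ -a_in-1}k\equiv0\pmod{n^2},$$ and $$\gcd(a_1+\cdots+a_m-1,2)\sum_{k=0}^{n-1}(3k^2+3k+1)\prod_{i=1}^m\binom{a_in-1}k\binom{ -a_in-1}k\equiv0\pmod{n^3}.$$ (ii) For any positive integers $a,b,n$: $$\frac1n\sum_{k=0}^{n-1}\frac{\binom{n-1}k^a\binom{ -n-1}k^a}{4k^2-1}\in\mathbb Z,\qquad \frac1n\sum_{k=0}^{n-1}\frac{\binom{n-1}k^a\binom{ -n-1}k^a}{\binom{k+2}2}\in\mathbb Z,$$ $$\frac1n\sum_{k=0}^{n-1}(-1)^k\left(1+\frac{2k}{4k^2-1}\right)\binom{n-1}k^a\binom{ -n-1}k^a\in\mathbb Z,\qquad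 \frac1n\sum_{k=0}^{n-1}(-1)^k\left(4-\frac{2k+3}{\binom{k+2}2}\right)\binom{n-1}k^a\binom{ -n-1}k^a\in\mathbb Z,$$ and $$\sum_{k=0}^{n-1}\frac{(-1)^{(a+b)k}}{4k^2-1}\binom{n-1}k^a\binom{ -n-1}k^b\in\mathbb Z,\qquad \sum_{k=0}^{n-1}\frac{(-1)^{(a+b-1)k}k}{4k^2-1}\binom{n-1}k^a\binom{ -n-1}k^b\in\mathbb Z,$$ $$\sum_{k=0}^{n-1}\frac{(-1)^{(a+b)k}}{\binom{k+2}2}\binom{n-1}k^a\binom{ -n-1}k^b\in\mathbb Z,\qquad \sum_{k=0}^{n-1}\frac{(-1)^{(a+b-1)k}(2k+3)}{\binom{k+2}2}\binom{n-1}k^a\binom{ -n-1}k^b\in\mathbb Z,$$ $$\sum_{k=0}^{n-1}\frac{(-1)^{(a+b)k}(3k+1)}{(2k+1)\binom{2k}k}\binom{n-1}k^a\binom{ -n-1}k^b\in\mathbb Z,\qquad \sum_{k=0}^{n-1}\frac{(-1)^{(a+b-1)k}(5k+3)}{(2k+1)\binom{2k}k}\binom{n-1}k^a\binom{ -n-1}k^b\in\mathbb Z.$$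
   Context: For an integer $x$ and $k\in\mathbb N$, $\binom xk=x(x-1)\cdots(x-k+1)/k!$ (so negative upper arguments are allowed, e.g. $\binom{ -n-1}k=(-1)^k\binom{n+k}k$). -}

module Defs where

open import Data.Nat using (ℕ; zero; suc; _!)
open import Data.Nat.Properties using (_!≢0)
open import Data.Fin using (Fin)
import Data.Fin as F
open import Data.Integer using (ℤ; +_; -[1+_]; _/ℕ_)
import Data.Integer as Z
open import Data.Rational using (ℚ; _/_; 0ℚ)
import Data.Rational as Q
open import Data.Product using (∃)
open import Relation.Binary.PropositionalEquality using (_≡_)

fall : ℤ → ℕ → ℤ
fall x zero    = + 1
fall x (suc k) = fall x k Z.* (x Z.- + k)

-- Generalised binomial coefficient  binom x k = x(x-1)...(x-k+1)/k!  (x ∈ ℤ, k ∈ ℕ),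
-- the division by k! being (exact) integer division.
binom : ℤ → ℕ → ℤ
binom x k = (fall x k /ℕ (k !)) {{k !≢0}}

sumℤ : ℕ → (ℕ → ℤ) → ℤ
sumℤ zero    f = + 0
sumℤ (suc n) f = sumℤ n f Z.+ f n

sumℚ : ℕ → (ℕ → ℚ) → ℚ
sumℚ zero    f = 0ℚ
sumℚ (suc n) f = sumℚ n f Q.+ f n

sumFin : (m : ℕ) → (Fin m → ℤ) → ℤ
sumFin zero    a = + 0
sumFin (suc m) a = a F.zero Z.+ sumFin m (λ i → a (F.suc i))

prodFin : (m : ℕ) → (Fin m → ℤ) → ℤ
prodFin zero    a = + 1
prodFin (suc m) a = a F.zero Z.* prodFin m (λ i → a (F.suc i))

toℚ : ℤ → ℚ
toℚ z = z / 1

-- division of a rational by an integer; the value for divisor 0 is an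
-- irrelevant junk value (all divisors in the theorem are nonzero).
infixl 7 _÷ℤ_
_÷ℤ_ : ℚ → ℤ → ℚ
p ÷ℤ (+ zero)    = 0ℚ
p ÷ℤ (+ (suc m)) = p Q.* (+ 1 / suc m)
p ÷ℤ -[1+ m ]    = p Q.* (-[1+ 0 ] / suc m)

IsInt : ℚ → Set
IsInt q = ∃ λ (z : ℤ) → q ≡ toℚ z

{-# OPTIONS --safe #-}
module Submission where

-- With u_k = (−1)^k C(an − 1, k) one has (k + 1)(u_{k+1} − u_k) = −an u_k.  Every sum
-- of the theorem has the form Σ ΔG(k) U_k, where U is a product of sequences u, so
-- summation by parts turns it into boundary terms and the sum of G(k + 1)(U_{k+1} − U_k).
-- In part (i) G is a polynomial, up to the sign (−1)^k, and the factors of k in G bring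
-- out powers of n; for the sharper moduli the linear term of U_{k+1} − U_k is kept and
-- leads back to the sums of U_k, (2k + 1) U_k and (3k² + 3k + 1) U_k modulo n.
-- In part (ii) G is rational with denominators 2k − 1, k + 1 or C(2k, k), which cancel
-- because v_k = C(n − 1, k) C(−n − 1, k) satisfies
-- n v_k = (−1)^k (k + 1) C(n + k, 2k + 1) C(2k + 1, k + 1).

open import Defs
open import Data.Nat using (ℕ; zero; suc; _<_; _≤_; _∸_; _!)
import Data.Nat as N
import Data.Nat.Divisibility as ℕ∣
import Data.Nat.Properties as ℕP
open import Data.Nat.Properties using (_!≢0)
open import Data.Fin using (Fin)
import Data.Fin as F
open import Data.Integer using (ℤ; +_; -[1+_]; _+_; _-_; _*_; _^_; -_)
import Data.Integer as Z
import Data.Integer.Properties as ℤP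
open import Data.Integer.DivMod using (a≡a%ℕn+[a/ℕn]*n; n%ℕd<d)
open import Data.Integer.Divisibility using (_∣_)
import Data.Integer.Divisibility.Signed as ℤ∣
open import Data.Integer.Divisibility.Signed using (divides) renaming (_∣_ to _∣ˢ_)
open import Data.Integer.GCD using (gcd; gcd-greatest)
open import Data.Integer.Tactic.RingSolver using (solve-∀)
open import Data.Rational using (ℚ; 0ℚ; 1ℚ; toℚᵘ)
import Data.Rational as Q
import Data.Rational.Properties as ℚP
open import Data.Rational.Solver using (module +-*-Solver)
import Data.Rational.Unnormalised as ℚᵘ
import Data.Rational.Unnormalised.Properties as ℚᵘP
open import Data.Empty using (⊥-elim)
open import Data.Product using (∃; ∃₂; _×_; _,_)
open import Data.Sum using (_⊎_; inj₁; inj₂; [_,_]′)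
open import Relation.Binary.PropositionalEquality
  using (_≡_; _≢_; refl; sym; trans; cong; cong₂; subst; subst₂; module ≡-Reasoning)

-- Binomial coefficients with integer upper argument

-- The factors gcd(a₁ + ... + a_m - 1, 2) and 6 pay for the linear term. Up to sign and with s = a₁
-- + ... + a_m, modulo n² it leaves s n Σ (k + 1) U_k or s n Σ (k + 1)² U_k. Only 2(k + 1) and 6(k +
-- 1)², not k + 1 and (k + 1)² themselves, are integral combinations of 1, 2k + 1 and 3k² + 3k + 1,
-- so only the double or the sixfold of these sums is known to be divisible by n. For even s the
-- coefficient supplies the 2, for odd s the gcd does. In part (ii) the single modulus c_k = C(2k +
-- 1, k + 1) serves all families: the denominators 2k + 1, k + 2 and C(2k + 2, k + 1) of G(k + 1)
-- all divide 2 c_k, the first even c_k, and the numerators supply the 2. While c_k divides the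
-- increments of v_k times any monomial in the two sequences u, it need not divide v_k itself before
-- the last index k = n - 1. The alternating sums with k/(4k² - 1) are special: there the
-- antidifference gives four times the summand, and the oddness of all denominators removes the 4.

fall-shift : ∀ x k → fall (+ 1 + x) (suc k) ≡ (+ 1 + x) * fall x k
fall-shift x zero    = lemma x
  where
  lemma : ∀ x → + 1 * (+ 1 + x - + 0) ≡ (+ 1 + x) * + 1
  lemma = solve-∀
fall-shift x (suc k) =
  trans (cong (_* (+ 1 + x - + suc k)) (fall-shift x k)) (lemma x (+ k) (fall x k))
  where
  lemma : ∀ x k f → (+ 1 + x) * f * (+ 1 + x - (+ 1 + k)) ≡ (+ 1 + x) * (f * (x - k))
  lemma = solve-∀

fall-pascal : ∀ x k → fall (+ 1 + x) (suc k) ≡ fall x (suc k) + + suc k * fall x k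
fall-pascal x k = trans (fall-shift x k) (lemma x (+ k) (fall x k))
  where
  lemma : ∀ x k f → (+ 1 + x) * f ≡ f * (x - k) + (+ 1 + k) * f
  lemma = solve-∀

!-suc : ∀ k → + (suc k !) ≡ + suc k * + (k !)
!-suc k = ℤP.pos-* (suc k) (k !)

-- Pascal's rule propagates divisibility from x to x ± 1, starting from x = 0.
!∣fall : ∀ k x → + (k !) ∣ˢ fall x k
!∣fall zero    x = divides (+ 1) refl
!∣fall (suc k) x = go x
  where
  increment : ∀ x → + (suc k !) ∣ˢ + suc k * fall x k
  increment x = subst (_∣ˢ + suc k * fall x k) (sym (!-suc k)) (ℤ∣.*-monoʳ-∣ (+ suc k) (!∣fall k x))

  up : ∀ x → + (suc k !) ∣ˢ fall x (suc k) → + (suc k !) ∣ˢ fall (+ 1 + x) (suc k)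
  up x h = subst (+ (suc k !) ∣ˢ_) (sym (fall-pascal x k)) (ℤ∣.∣m∣n⇒∣m+n h (increment x))

  down : ∀ x → + (suc k !) ∣ˢ fall (+ 1 + x) (suc k) → + (suc k !) ∣ˢ fall x (suc k)
  down x h = ℤ∣.∣m+n∣n⇒∣m (subst (+ (suc k !) ∣ˢ_) (fall-pascal x k) h) (increment x)

  go : ∀ x → + (suc k !) ∣ˢ fall x (suc k)
  go (+ zero)     = divides (+ 0) (trans (fall-shift -[1+ 0 ] k) (ℤP.*-zeroˡ (fall -[1+ 0 ] k)))
  go (+ suc m)    = up (+ m) (go (+ m))
  go -[1+ zero ]  = down -[1+ 0 ] (go (+ 0))
  go -[1+ suc m ] = down -[1+ suc m ] (go -[1+ m ])

-- Turns the truncating division in the definition of `binom` into the exact identity `binom-!`,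
-- from which all recursions follow by cancelling k!.
/ℕ-exact : ∀ x d .{{_ : N.NonZero d}} → + d ∣ˢ x → (x Z./ℕ d) * + d ≡ x
/ℕ-exact x d d∣x = sym (trans division (trans (cong (λ t → + t + q * + d) r≡0) (ℤP.+-identityˡ (q * + d))))
  where
  q = x Z./ℕ d
  r = x Z.%ℕ d
  division : x ≡ + r + q * + d
  division = a≡a%ℕn+[a/ℕn]*n x d
  d∣r : d ℕ∣.∣ r
  d∣r = ℤ∣.∣⇒∣ᵤ {i = + r} (ℤ∣.∣m+n∣n⇒∣m {m = + r} (subst (+ d ∣ˢ_) division d∣x) (divides q refl))
  zero-remainder : ∀ r → d ℕ∣.∣ r → r N.< d → r ≡ 0
  zero-remainder zero    _   _   = refl
  zero-remainder (suc r) d∣r r<d = ⊥-elim (ℕ∣.>⇒∤ r<d d∣r)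
  r≡0 : r ≡ 0
  r≡0 = zero-remainder r d∣r (n%ℕd<d x d)

binom-! : ∀ x k → binom x k * + (k !) ≡ fall x k
binom-! x k = /ℕ-exact (fall x k) (k !) {{k !≢0}} (!∣fall k x)

cancel-! : ∀ k {x y} → x * + (k !) ≡ y * + (k !) → x ≡ y
cancel-! k {x} {y} = ℤP.*-cancelʳ-≡ x y (+ (k !)) {{k !≢0}}

binom-suc : ∀ x k → + suc k * binom x (suc k) ≡ (x - + k) * binom x k
binom-suc x k = cancel-! k (begin
  + suc k * binom x (suc k) * + (k !)    ≡⟨ lemma₁ (+ suc k) (binom x (suc k)) (+ (k !)) ⟩
  binom x (suc k) * (+ suc k * + (k !))  ≡⟨ cong (binom x (suc k) *_) (!-suc k) ⟨
  binom x (suc k) * + (suc k !)          ≡⟨ binom-! x (suc k) ⟩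
  fall x k * (x - + k)                   ≡⟨ cong (_* (x - + k)) (binom-! x k) ⟨
  binom x k * + (k !) * (x - + k)        ≡⟨ lemma₂ (binom x k) (+ (k !)) (x - + k) ⟩
  (x - + k) * binom x k * + (k !)        ∎)
  where
  open ≡-Reasoning
  lemma₁ : ∀ a b c → a * b * c ≡ b * (a * c)
  lemma₁ = solve-∀
  lemma₂ : ∀ a b c → a * b * c ≡ c * a * b
  lemma₂ = solve-∀

binom-shift : ∀ x k → + suc k * binom (+ 1 + x) (suc k) ≡ (+ 1 + x) * binom x k
binom-shift x k = cancel-! k (begin
  + suc k * binom (+ 1 + x) (suc k) * + (k !)    ≡⟨ lemma₁ (+ suc k) (binom (+ 1 + x) (suc k)) (+ (k !)) ⟩
  binom (+ 1 + x) (suc k) * (+ suc k * + (k !))  ≡⟨ cong (binom (+ 1 + x) (suc k) *_) (!-suc k) ⟨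
  binom (+ 1 + x) (suc k) * + (suc k !)          ≡⟨ binom-! (+ 1 + x) (suc k) ⟩
  fall (+ 1 + x) (suc k)                         ≡⟨ fall-shift x k ⟩
  (+ 1 + x) * fall x k                           ≡⟨ cong ((+ 1 + x) *_) (binom-! x k) ⟨
  (+ 1 + x) * (binom x k * + (k !))              ≡⟨ ℤP.*-assoc (+ 1 + x) (binom x k) (+ (k !)) ⟨
  (+ 1 + x) * binom x k * + (k !)                ∎)
  where
  open ≡-Reasoning
  lemma₁ : ∀ a b c → a * b * c ≡ b * (a * c)
  lemma₁ = solve-∀

-- Signed binomial sequences and their increments

sign : ℕ → ℤ
sign k = -[1+ 0 ] ^ k

-- The sign turns the ratio of consecutive terms into (k + 1 - x)/(k + 1), which is close to 1
-- rather than -1 when x is a multiple of the modulus.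
u : ℤ → ℕ → ℤ
u x k = sign k * binom (x - + 1) k

u-suc : ∀ x k → + suc k * u x (suc k) ≡ (+ suc k - x) * u x k
u-suc x k = begin
  + suc k * (-[1+ 0 ] * sign k * binom (x - + 1) (suc k))  ≡⟨ lemma₁ (+ suc k) (sign k) (binom (x - + 1) (suc k)) ⟩
  - sign k * (+ suc k * binom (x - + 1) (suc k))           ≡⟨ cong (- sign k *_) (binom-suc (x - + 1) k) ⟩
  - sign k * ((x - + 1 - + k) * binom (x - + 1) k)         ≡⟨ lemma₂ x (+ k) (sign k) (binom (x - + 1) k) ⟩
  (+ 1 + + k - x) * (sign k * binom (x - + 1) k)           ∎
  where
  open ≡-Reasoning
  lemma₁ : ∀ a s b → a * (-[1+ 0 ] * s * b) ≡ - s * (a * b)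
  lemma₁ = solve-∀
  lemma₂ : ∀ x k s b → - s * ((x - + 1 - k) * b) ≡ (+ 1 + k - x) * (s * b)
  lemma₂ = solve-∀

u-step : ∀ x k → + suc k * (u x (suc k) - u x k) ≡ - x * u x k
u-step x k = trans (lemma₁ (+ suc k) (u x (suc k)) (u x k))
  (trans (cong (_- + suc k * u x k) (u-suc x k)) (lemma₂ (+ suc k) x (u x k)))
  where
  lemma₁ : ∀ a b c → a * (b - c) ≡ a * b - a * c
  lemma₁ = solve-∀
  lemma₂ : ∀ a x c → (a - x) * c - a * c ≡ - x * c
  lemma₂ = solve-∀

v : ℤ → ℕ → ℤ
v x k = u x k * u (- x) k

-- The two ratios multiply to (K - x)(K + x)/K², so the first-order term in x drops out. This gain
-- of a power of x is what raises the moduli for products of two binomials.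
v-step : ∀ x k → + suc k * + suc k * (v x (suc k) - v x k) ≡ - (x * x) * v x k
v-step x k = begin
  K * K * (u x (suc k) * u (- x) (suc k) - v x k)          ≡⟨ lemma₁ K (u x (suc k)) (u (- x) (suc k)) (v x k) ⟩
  K * u x (suc k) * (K * u (- x) (suc k)) - K * K * v x k  ≡⟨ cong₂ (λ s t → s * t - K * K * v x k) (u-suc x k) (u-suc (- x) k) ⟩
  (K - x) * u x k * ((K - - x) * u (- x) k) - K * K * v x k  ≡⟨ lemma₂ K x (u x k) (u (- x) k) ⟩
  - (x * x) * v x k                                        ∎
  where
  open ≡-Reasoning
  K = + suc k
  lemma₁ : ∀ K a b c → K * K * (a * b - c) ≡ K * a * (K * b) - K * K * c
  lemma₁ = solve-∀
  lemma₂ : ∀ K x a b → (K - x) * a * ((K - - x) * b) - K * K * (a * b) ≡ - (x * x) * (a * b)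
  lemma₂ = solve-∀

sign² : ∀ k → sign k * sign k ≡ + 1
sign² zero    = refl
sign² (suc k) = trans (lemma (sign k)) (sign² k)
  where
  lemma : ∀ s → -[1+ 0 ] * s * (-[1+ 0 ] * s) ≡ s * s
  lemma = solve-∀

v-binom : ∀ x k → v x k ≡ binom (x - + 1) k * binom (- x - + 1) k
v-binom x k = trans (lemma (sign k) b c) (trans (cong (_* (b * c)) (sign² k)) (ℤP.*-identityˡ (b * c)))
  where
  b = binom (x - + 1) k
  c = binom (- x - + 1) k
  lemma : ∀ s b c → s * b * (s * c) ≡ s * s * (b * c)
  lemma = solve-∀

-- First-order expansion of products

-- A product rule for weighted increments. The weight `c` stays general because it is later k + 1,
-- (k + 1)² and `v x k`.
*-step-∣ : ∀ {d} c x x′ y y′ → d ∣ˢ c * (x′ - x) → d ∣ˢ c * (y′ - y) → d ∣ˢ c * (x′ * y′ - x * y)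
*-step-∣ {d} c x x′ y y′ h₁ h₂ =
  subst (d ∣ˢ_) (sym (lemma c x x′ y y′)) (ℤ∣.∣m∣n⇒∣m+n (ℤ∣.∣m⇒∣m*n y′ h₁) (ℤ∣.∣n⇒∣m*n x h₂))
  where
  lemma : ∀ c x x′ y y′ → c * (x′ * y′ - x * y) ≡ c * (x′ - x) * y′ + x * (c * (y′ - y))
  lemma = solve-∀

∣*[1-1] : ∀ {d} c → d ∣ˢ c * (+ 1 - + 1)
∣*[1-1] c = divides (+ 0) (ℤP.*-zeroʳ c)

^-step-∣ : ∀ {d} c x x′ → d ∣ˢ c * (x′ - x) → ∀ a → d ∣ˢ c * (x′ ^ a - x ^ a)
^-step-∣ c x x′ h zero    = ∣*[1-1] c
^-step-∣ c x x′ h (suc a) = *-step-∣ c x x′ (x ^ a) (x′ ^ a) h (^-step-∣ c x x′ h a)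

prodFin-step-∣ : ∀ {d} c m (x x′ : Fin m → ℤ) → (∀ i → d ∣ˢ c * (x′ i - x i)) →
                 d ∣ˢ c * (prodFin m x′ - prodFin m x)
prodFin-step-∣ c zero    x x′ h = ∣*[1-1] c
prodFin-step-∣ c (suc m) x x′ h =
  *-step-∣ c (x F.zero) (x′ F.zero) _ _ (h F.zero)
    (prodFin-step-∣ c m (λ i → x (F.suc i)) (λ i → x′ (F.suc i)) (λ i → h (F.suc i)))

-- The first-order term of ∏ x′ᵢ − ∏ xᵢ in the increments x′ᵢ − xᵢ.
prodFin-step-linear : ∀ k K n N m (b x x′ : Fin m → ℤ) →
  (∀ i → K * (x′ i - x i) ≡ N * (b i * x i)) → (∀ i → n ∣ˢ k * (x′ i - x i)) →
  N * n ∣ˢ k * K * (prodFin m x′ - prodFin m x) - N * (k * sumFin m b * prodFin m x)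
prodFin-step-linear k K n N zero    b x x′ e h = divides (+ 0) (lemma k K N n)
  where
  lemma : ∀ k K N n → k * K * (+ 1 - + 1) - N * (k * + 0 * + 1) ≡ + 0 * (N * n)
  lemma = solve-∀
prodFin-step-linear k K n N (suc m) b x x′ e h = subst (N * n ∣ˢ_) (sym eq)
  (ℤ∣.∣m∣n⇒∣m+n
    (ℤ∣.∣n⇒∣m*n x₀ (prodFin-step-linear k K n N m _ _ _ (λ i → e (F.suc i)) (λ i → h (F.suc i))))
    (ℤ∣.∣n⇒∣m*n (b₀ * x₀) (ℤ∣.*-monoʳ-∣ N
      (prodFin-step-∣ k m (λ i → x (F.suc i)) (λ i → x′ (F.suc i)) (λ i → h (F.suc i))))))
  where
  x₀ = x F.zero
  x₀′ = x′ F.zero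
  b₀ = b F.zero
  X = prodFin m (λ i → x (F.suc i))
  X′ = prodFin m (λ i → x′ (F.suc i))
  B = sumFin m (λ i → b (F.suc i))
  lemma₁ : ∀ k K N x₀ x₀′ b₀ X X′ B →
    k * K * (x₀′ * X′ - x₀ * X) - N * (k * (b₀ + B) * (x₀ * X)) ≡
    K * (x₀′ - x₀) * (k * X′) + (x₀ * (k * K * (X′ - X)) - N * (k * (b₀ + B) * (x₀ * X)))
  lemma₁ = solve-∀
  lemma₂ : ∀ k K N x₀ b₀ X X′ B →
    N * (b₀ * x₀) * (k * X′) + (x₀ * (k * K * (X′ - X)) - N * (k * (b₀ + B) * (x₀ * X))) ≡
    x₀ * (k * K * (X′ - X) - N * (k * B * X)) + b₀ * x₀ * (N * (k * (X′ - X)))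
  lemma₂ = solve-∀
  eq : k * K * (x₀′ * X′ - x₀ * X) - N * (k * (b₀ + B) * (x₀ * X)) ≡
       x₀ * (k * K * (X′ - X) - N * (k * B * X)) + b₀ * x₀ * (N * (k * (X′ - X)))
  -- The increment of the first factor is replaced by its exact value N b₀ x₀. In that term X′ then
  -- becomes X at the cost of N · k (X′ - X), a multiple of N n.
  eq = trans (lemma₁ k K N x₀ x₀′ b₀ X X′ B)
    (trans (cong (λ t → t * (k * X′) + (x₀ * (k * K * (X′ - X)) - N * (k * (b₀ + B) * (x₀ * X)))) (e F.zero))
      (lemma₂ k K N x₀ b₀ X X′ B))

-- Summation by parts

sumℤ-cong : ∀ n {f g : ℕ → ℤ} → (∀ k → f k ≡ g k) → sumℤ n f ≡ sumℤ n g
sumℤ-cong zero    f≗g = refl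
sumℤ-cong (suc n) f≗g = cong₂ _+_ (sumℤ-cong n f≗g) (f≗g n)

sumℤ-+ : ∀ n (f g : ℕ → ℤ) → sumℤ n (λ k → f k + g k) ≡ sumℤ n f + sumℤ n g
sumℤ-+ zero    f g = refl
sumℤ-+ (suc n) f g = trans (cong (_+ (f n + g n)) (sumℤ-+ n f g)) (lemma (sumℤ n f) (sumℤ n g) (f n) (g n))
  where
  lemma : ∀ a b c d → a + b + (c + d) ≡ a + c + (b + d)
  lemma = solve-∀

sumℤ-*ˡ : ∀ n c (f : ℕ → ℤ) → sumℤ n (λ k → c * f k) ≡ c * sumℤ n f
sumℤ-*ˡ zero    c f = sym (ℤP.*-zeroʳ c)
sumℤ-*ˡ (suc n) c f = trans (cong (_+ c * f n) (sumℤ-*ˡ n c f)) (sym (ℤP.*-distribˡ-+ c (sumℤ n f) (f n)))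

∣-sumℤ : ∀ {d} n (f : ℕ → ℤ) → (∀ k → d ∣ˢ f k) → d ∣ˢ sumℤ n f
∣-sumℤ zero    f h = divides (+ 0) refl
∣-sumℤ (suc n) f h = ℤ∣.∣m∣n⇒∣m+n (∣-sumℤ n f h) (h n)

-- The boundary term uses the last summed value `U n`, so the remainder has one term fewer and the
-- increment from `U n` to `U (suc n)` never enters.
sumℤ-by-parts : ∀ (f G U : ℕ → ℤ) → (∀ k → G (suc k) - G k ≡ f k) → G 0 ≡ + 0 → ∀ n →
  sumℤ (suc n) (λ k → f k * U k) ≡ G (suc n) * U n - sumℤ n (λ k → G (suc k) * (U (suc k) - U k))
sumℤ-by-parts f G U ΔG G0 zero = begin
  + 0 + f 0 * U 0                ≡⟨ cong (λ t → + 0 + t * U 0) (ΔG 0) ⟨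
  + 0 + (G 1 - G 0) * U 0        ≡⟨ cong (λ t → + 0 + (G 1 - t) * U 0) G0 ⟩
  + 0 + (G 1 - + 0) * U 0        ≡⟨ lemma (G 1) (U 0) ⟩
  G 1 * U 0 - + 0                ∎
  where
  open ≡-Reasoning
  lemma : ∀ g x → + 0 + (g - + 0) * x ≡ g * x - + 0
  lemma = solve-∀
sumℤ-by-parts f G U ΔG G0 (suc n) = begin
  sumℤ (suc n) (λ k → f k * U k) + f (suc n) * U (suc n)
    ≡⟨ cong₂ (λ s t → s + t * U (suc n)) (sumℤ-by-parts f G U ΔG G0 n) (sym (ΔG (suc n))) ⟩
  G (suc n) * U n - σ + (G (suc (suc n)) - G (suc n)) * U (suc n)
    ≡⟨ lemma (G (suc n)) (U n) σ (G (suc (suc n))) (U (suc n)) ⟩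
  G (suc (suc n)) * U (suc n) - (σ + G (suc n) * (U (suc n) - U n)) ∎
  where
  open ≡-Reasoning
  σ = sumℤ n (λ k → G (suc k) * (U (suc k) - U k))
  lemma : ∀ g x s h y → g * x - s + (h - g) * y ≡ h * y - (s + g * (y - x))
  lemma = solve-∀

∣-sumℤ-by-parts : ∀ {d} (f G U : ℕ → ℤ) n → (∀ k → G (suc k) - G k ≡ f k) → G 0 ≡ + 0 → d ∣ˢ G (suc n) →
  (∀ k → d ∣ˢ G (suc k) * (U (suc k) - U k)) → d ∣ˢ sumℤ (suc n) (λ k → f k * U k)
∣-sumℤ-by-parts {d} f G U n ΔG G0 last h = subst (d ∣ˢ_) (sym (sumℤ-by-parts f G U ΔG G0 n))
  (ℤ∣.∣m∣n⇒∣m-n (ℤ∣.∣m⇒∣m*n (U n) last) (∣-sumℤ n _ h))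

-- For increments that survive to first order: the remainder is then congruent to a sum of lower
-- weight, which carries a factor N and needs only a weaker divisibility.
∣-sumℤ-by-parts-linear : ∀ {d} N (f G H U : ℕ → ℤ) n → (∀ k → G (suc k) - G k ≡ f k) → G 0 ≡ + 0 → d ∣ˢ G (suc n) →
  (∀ k → d ∣ˢ G (suc k) * (U (suc k) - U k) - N * (H k * U k)) →
  d ∣ˢ sumℤ (suc n) (λ k → f k * U k) + N * sumℤ n (λ k → H k * U k)
∣-sumℤ-by-parts-linear {d} N f G H U n ΔG G0 last h = subst (d ∣ˢ_) (sym eq)
  (ℤ∣.∣m∣n⇒∣m-n (ℤ∣.∣m⇒∣m*n (U n) last) (∣-sumℤ n _ h))
  where
  open ≡-Reasoning
  g : ℕ → ℤ
  g k = G (suc k) * (U (suc k) - U k)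
  rest : ℕ → ℤ
  rest k = g k - N * (H k * U k)
  lemma₁ : ∀ a b → a ≡ (a - b) + b
  lemma₁ = solve-∀
  lemma₂ : ∀ a b c → a - (b + c) + c ≡ a - b
  lemma₂ = solve-∀
  eq : sumℤ (suc n) (λ k → f k * U k) + N * sumℤ n (λ k → H k * U k) ≡ G (suc n) * U n - sumℤ n rest
  eq = begin
    sumℤ (suc n) (λ k → f k * U k) + N * sumℤ n (λ k → H k * U k)
      ≡⟨ cong₂ _+_ (sumℤ-by-parts f G U ΔG G0 n) (sym (sumℤ-*ˡ n N (λ k → H k * U k))) ⟩
    G (suc n) * U n - sumℤ n g + sumℤ n (λ k → N * (H k * U k))
      ≡⟨ cong (λ t → G (suc n) * U n - t + sumℤ n (λ k → N * (H k * U k)))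
           (trans (sumℤ-cong n (λ k → lemma₁ (g k) (N * (H k * U k)))) (sumℤ-+ n rest (λ k → N * (H k * U k)))) ⟩
    G (suc n) * U n - (sumℤ n rest + sumℤ n (λ k → N * (H k * U k))) + sumℤ n (λ k → N * (H k * U k))
      ≡⟨ lemma₂ (G (suc n) * U n) (sumℤ n rest) (sumℤ n (λ k → N * (H k * U k))) ⟩
    G (suc n) * U n - sumℤ n rest ∎

-- Parity

parity : ∀ s → + 2 ∣ˢ s ⊎ + 2 ∣ˢ s - + 1
parity s = go (s Z.%ℕ 2) (a≡a%ℕn+[a/ℕn]*n s 2) (n%ℕd<d s 2)
  where
  q = s Z./ℕ 2
  lemma₁ : ∀ q → + 0 + q * + 2 ≡ q * + 2
  lemma₁ = solve-∀
  lemma₂ : ∀ q → + 1 + q * + 2 - + 1 ≡ q * + 2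
  lemma₂ = solve-∀
  go : ∀ r → s ≡ + r + q * + 2 → r N.< 2 → + 2 ∣ˢ s ⊎ + 2 ∣ˢ s - + 1
  go 0 e _ = inj₁ (divides q (trans e (lemma₁ q)))
  go 1 e _ = inj₂ (divides q (trans (cong (_- + 1) e) (lemma₂ q)))
  go (suc (suc _)) _ (N.s≤s (N.s≤s ()))

-- If s is even then so is b, because s + b is; if s is odd the gcd itself is a multiple of 2.
2∣gcd*s : ∀ s b → + 2 ∣ˢ s + b → + 2 ∣ˢ gcd (s - + 1) (+ 2) * b
2∣gcd*s s b h with parity s
... | inj₁ e = ℤ∣.∣n⇒∣m*n (gcd (s - + 1) (+ 2)) (ℤ∣.∣m+n∣m⇒∣n h e)
... | inj₂ o = ℤ∣.∣m⇒∣m*n {m = g} b (ℤ∣.∣ᵤ⇒∣ {+ 2} {g}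
  (gcd-greatest {s - + 1} {+ 2} {+ 2} (ℤ∣.∣⇒∣ᵤ {+ 2} {s - + 1} o) (ℤ∣.∣⇒∣ᵤ (ℤ∣.∣-refl {+ 2}))))
  where g = gcd (s - + 1) (+ 2)

sumFin-even : ∀ m (a b : Fin m → ℤ) → (∀ i → + 2 ∣ˢ a i + b i) → + 2 ∣ˢ sumFin m a + sumFin m b
sumFin-even zero    a b h = divides (+ 0) refl
sumFin-even (suc m) a b h = subst (+ 2 ∣ˢ_) (lemma (a F.zero) (b F.zero) _ _)
  (ℤ∣.∣m∣n⇒∣m+n (h F.zero) (sumFin-even m (λ i → a (F.suc i)) (λ i → b (F.suc i)) (λ i → h (F.suc i))))
  where
  lemma : ∀ a b c d → a + b + (c + d) ≡ a + c + (b + d)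
  lemma = solve-∀

-- Part (i)

^-distribʳ-* : ∀ x y n → (x * y) ^ n ≡ x ^ n * y ^ n
^-distribʳ-* x y zero    = refl
^-distribʳ-* x y (suc n) = trans (cong (x * y *_) (^-distribʳ-* x y n)) (lemma x y (x ^ n) (y ^ n))
  where
  lemma : ∀ a b c d → a * b * (c * d) ≡ a * c * (b * d)
  lemma = solve-∀

prodFin-cong : ∀ m {f g : Fin m → ℤ} → (∀ i → f i ≡ g i) → prodFin m f ≡ prodFin m g
prodFin-cong zero    f≗g = refl
prodFin-cong (suc m) f≗g = cong₂ _*_ (f≗g F.zero) (prodFin-cong m (λ i → f≗g (F.suc i)))

prodFin-scale : ∀ m c (f : Fin m → ℤ) → prodFin m (λ i → c * f i) ≡ c ^ m * prodFin m f
prodFin-scale zero    c f = refl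
prodFin-scale (suc m) c f = trans (cong (c * f F.zero *_) (prodFin-scale m c (λ i → f (F.suc i))))
  (lemma c (f F.zero) (c ^ m) (prodFin m (λ i → f (F.suc i))))
  where
  lemma : ∀ a b c d → a * b * (c * d) ≡ a * c * (b * d)
  lemma = solve-∀

sign-unit : ∀ m → sign m ≡ + 1 ⊎ sign m ≡ -[1+ 0 ]
sign-unit zero = inj₁ refl
sign-unit (suc m) with sign-unit m
... | inj₁ e = inj₂ (cong (-[1+ 0 ] *_) e)
... | inj₂ e = inj₁ (cong (-[1+ 0 ] *_) e)

unit-* : ∀ {x y} → x ≡ + 1 ⊎ x ≡ -[1+ 0 ] → y ≡ + 1 ⊎ y ≡ -[1+ 0 ] → x * y ≡ + 1 ⊎ x * y ≡ -[1+ 0 ]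
unit-* (inj₁ refl) (inj₁ refl) = inj₁ refl
unit-* (inj₁ refl) (inj₂ refl) = inj₂ refl
unit-* (inj₂ refl) (inj₁ refl) = inj₂ refl
unit-* (inj₂ refl) (inj₂ refl) = inj₁ refl

-- The only property of a product of signed binomials that the congruences modulo n use; it passes
-- to products by the product rule.
Slow : ℤ → (ℕ → ℤ) → Set
Slow n U = ∀ k → n ∣ˢ + suc k * (U (suc k) - U k)

*-step-∣ˡ : ∀ {d} K g D → d ∣ˢ K * D → d ∣ˢ K * g * D
*-step-∣ˡ {d} K g D h = subst (d ∣ˢ_) (lemma K g D) (ℤ∣.∣n⇒∣m*n g h)
  where
  lemma : ∀ K g D → g * (K * D) ≡ K * g * D
  lemma = solve-∀

-- Both antidifferences carry a factor k: at the upper end it equals the modulus, and inside the sum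
-- it is absorbed by `Slow`. For ε = -1 the antidifference is -(-1)^k k G⁻(k), whose alternation
-- turns the difference in the first hypothesis into a sum in the second.
^-unit-sum : ∀ {n} ε → ε ≡ + 1 ⊎ ε ≡ -[1+ 0 ] → (f : ℕ → ℤ) (G⁺ G⁻ : ℕ → ℤ) →
  (∀ k → + suc k * G⁺ (suc k) - + k * G⁺ k ≡ f k) →
  (∀ k → + suc k * G⁻ (suc k) + + k * G⁻ k ≡ f k) →
  ∀ U → Slow (+ suc n) U → + suc n ∣ˢ sumℤ (suc n) (λ k → ε ^ k * f k * U k)
^-unit-sum {n} ε (inj₁ refl) f G⁺ G⁻ e⁺ e⁻ U slow =
  ∣-sumℤ-by-parts (λ k → (+ 1) ^ k * f k) (λ k → + k * G⁺ k) U n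
    (λ k → trans (e⁺ k) (sym (trans (cong (_* f k) (ℤP.^-zeroˡ k)) (ℤP.*-identityˡ (f k)))))
    (ℤP.*-zeroˡ (G⁺ 0))
    (ℤ∣.∣m⇒∣m*n (G⁺ (suc n)) ℤ∣.∣-refl)
    (λ k → *-step-∣ˡ (+ suc k) (G⁺ (suc k)) _ (slow k))
^-unit-sum {n} ε (inj₂ refl) f G⁺ G⁻ e⁺ e⁻ U slow =
  ∣-sumℤ-by-parts (λ k → sign k * f k) (λ k → + k * (- sign k * G⁻ k)) U n
    (λ k → trans (lemma (+ k) (sign k) (G⁻ k) (G⁻ (suc k))) (cong (sign k *_) (e⁻ k)))
    (ℤP.*-zeroˡ (- sign 0 * G⁻ 0))
    (ℤ∣.∣m⇒∣m*n (- sign (suc n) * G⁻ (suc n)) ℤ∣.∣-refl)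
    (λ k → *-step-∣ˡ (+ suc k) (- sign (suc k) * G⁻ (suc k)) _ (slow k))
  where
  lemma : ∀ k s g h → (+ 1 + k) * (- (-[1+ 0 ] * s) * h) - k * (- s * g) ≡ s * ((+ 1 + k) * h + k * g)
  lemma = solve-∀

-- These weights are differences of polynomials divisible by k: w₁ = Δ(k²), w₂ = Δ(k³), w₃ = Δ(k²(k
-- - 1)² - k). With alternating signs, (-1)^k w₁ = -Δ((-1)^k k) and (-1)^k w₃ = -Δ((-1)^k k²(2k -
-- 3)).
w₁ w₂ w₃ : ℕ → ℤ
w₁ k = + 2 * + k + + 1
w₂ k = + 3 * (+ k) ^ 2 + + 3 * + k + + 1
w₃ k = + 4 * (+ k) ^ 3 - + 1

unit-sum-w₁ : ∀ {n} ε → ε ≡ + 1 ⊎ ε ≡ -[1+ 0 ] → ∀ U → Slow (+ suc n) U →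
  + suc n ∣ˢ sumℤ (suc n) (λ k → ε ^ k * w₁ k * U k)
unit-sum-w₁ ε ε=±1 = ^-unit-sum ε ε=±1 w₁ (λ k → + k) (λ _ → + 1) (λ k → e⁺ (+ k)) (λ k → e⁻ (+ k))
  where
  e⁺ : ∀ k → (+ 1 + k) * (+ 1 + k) - k * k ≡ + 2 * k + + 1
  e⁺ = solve-∀
  e⁻ : ∀ k → (+ 1 + k) * + 1 + k * + 1 ≡ + 2 * k + + 1
  e⁻ = solve-∀

unit-sum-w₃ : ∀ {n} ε → ε ≡ + 1 ⊎ ε ≡ -[1+ 0 ] → ∀ U → Slow (+ suc n) U →
  + suc n ∣ˢ sumℤ (suc n) (λ k → ε ^ k * w₃ k * U k)
unit-sum-w₃ ε ε=±1 = ^-unit-sum ε ε=±1 w₃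
  (λ k → + k * (+ k - + 1) * (+ k - + 1) - + 1) (λ k → + k * (+ 2 * + k - + 3)) (λ k → e⁺ (+ k)) (λ k → e⁻ (+ k))
  where
  e⁺ : ∀ k → (+ 1 + k) * ((+ 1 + k) * (+ 1 + k - + 1) * (+ 1 + k - + 1) - + 1) - k * (k * (k - + 1) * (k - + 1) - + 1)
             ≡ + 4 * (k * (k * (k * + 1))) - + 1
  e⁺ = solve-∀
  e⁻ : ∀ k → (+ 1 + k) * ((+ 1 + k) * (+ 2 * (+ 1 + k) - + 3)) + k * (k * (+ 2 * k - + 3))
             ≡ + 4 * (k * (k * (k * + 1))) - + 1
  e⁻ = solve-∀

sum-1 : ∀ {n} U → Slow (+ suc n) U → + suc n ∣ˢ sumℤ (suc n) (λ k → + 1 * U k)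
sum-1 {n} U slow = ∣-sumℤ-by-parts (λ _ → + 1) (λ k → + k) U n (λ k → lemma (+ k)) refl ℤ∣.∣-refl slow
  where
  lemma : ∀ k → + 1 + k - k ≡ + 1
  lemma = solve-∀

sum-w₁ : ∀ {n} U → Slow (+ suc n) U → + suc n ∣ˢ sumℤ (suc n) (λ k → w₁ k * U k)
sum-w₁ {n} U slow = ∣-sumℤ-by-parts w₁ (λ k → + k * + k) U n (λ k → lemma (+ k)) refl
  (ℤ∣.∣m⇒∣m*n (+ suc n) ℤ∣.∣-refl) (λ k → *-step-∣ˡ (+ suc k) (+ suc k) _ (slow k))
  where
  lemma : ∀ k → (+ 1 + k) * (+ 1 + k) - k * k ≡ + 2 * k + + 1
  lemma = solve-∀

sum-w₂ : ∀ {n} U → Slow (+ suc n) U → + suc n ∣ˢ sumℤ (suc n) (λ k → w₂ k * U k)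
sum-w₂ {n} U slow = ∣-sumℤ-by-parts w₂ (λ k → + k * (+ k * + k)) U n (λ k → lemma (+ k)) refl
  (ℤ∣.∣m⇒∣m*n (+ suc n * + suc n) ℤ∣.∣-refl) (λ k → *-step-∣ˡ (+ suc k) (+ suc k * + suc k) _ (slow k))
  where
  lemma : ∀ k → (+ 1 + k) * ((+ 1 + k) * (+ 1 + k)) - k * (k * k) ≡ + 3 * (k * (k * + 1)) + + 3 * k + + 1
  lemma = solve-∀

-- Bridges an off-by-one: summation by parts leaves a sum with one term fewer, and the dropped term
-- has the factor `suc n`.
drop-last : ∀ {d} c n (f : ℕ → ℤ) → d ∣ˢ c * sumℤ (suc n) f → d ∣ˢ f n → d ∣ˢ c * sumℤ n f
drop-last {d} c n f h l = subst (d ∣ˢ_) (lemma c (sumℤ n f) (f n)) (ℤ∣.∣m∣n⇒∣m-n h (ℤ∣.∣n⇒∣m*n c l))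
  where
  lemma : ∀ c a b → c * (a + b) - c * b ≡ c * a
  lemma = solve-∀

-- From 2(k + 1) = (2k + 1) + 1. Without the 2 the claim fails already for modulus 2 and constant U
-- = 1.
2*sum-suc : ∀ {n} U → Slow (+ suc n) U → + suc n ∣ˢ + 2 * sumℤ n (λ k → + suc k * U k)
2*sum-suc {n} U slow = drop-last (+ 2) n (λ k → + suc k * U k)
  (subst (+ suc n ∣ˢ_) (sym eq) (ℤ∣.∣m∣n⇒∣m+n (sum-w₁ U slow) (sum-1 U slow))) (ℤ∣.∣m⇒∣m*n (U n) ℤ∣.∣-refl)
  where
  lemma : ∀ k u → + 2 * ((+ 1 + k) * u) ≡ (+ 2 * k + + 1) * u + + 1 * u
  lemma = solve-∀
  eq : + 2 * sumℤ (suc n) (λ k → + suc k * U k) ≡ sumℤ (suc n) (λ k → w₁ k * U k) + sumℤ (suc n) (λ k → + 1 * U k)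
  eq = trans (sym (sumℤ-*ˡ (suc n) (+ 2) (λ k → + suc k * U k)))
    (trans (sumℤ-cong (suc n) (λ k → lemma (+ k) (U k))) (sumℤ-+ (suc n) (λ k → w₁ k * U k) (λ k → + 1 * U k)))

-- From 6(k + 1)² = 2(3k² + 3k + 1) + 3(2k + 1) + 1.
6*sum-suc² : ∀ {n} U → Slow (+ suc n) U → + suc n ∣ˢ + 6 * sumℤ n (λ k → + suc k * + suc k * U k)
6*sum-suc² {n} U slow = drop-last (+ 6) n (λ k → + suc k * + suc k * U k)
  (subst (+ suc n ∣ˢ_) (sym eq)
    (ℤ∣.∣m∣n⇒∣m+n (ℤ∣.∣m∣n⇒∣m+n (ℤ∣.∣n⇒∣m*n (+ 2) (sum-w₂ U slow)) (ℤ∣.∣n⇒∣m*n (+ 3) (sum-w₁ U slow))) (sum-1 U slow)))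
  (ℤ∣.∣m⇒∣m*n (U n) (ℤ∣.∣m⇒∣m*n (+ suc n) ℤ∣.∣-refl))
  where
  lemma : ∀ k u → + 6 * ((+ 1 + k) * (+ 1 + k) * u) ≡
    + 2 * ((+ 3 * (k * (k * + 1)) + + 3 * k + + 1) * u) + + 3 * ((+ 2 * k + + 1) * u) + + 1 * u
  lemma = solve-∀
  f₁ f₂ : ℕ → ℤ
  f₁ k = w₁ k * U k
  f₂ k = w₂ k * U k
  eq : + 6 * sumℤ (suc n) (λ k → + suc k * + suc k * U k) ≡
       + 2 * sumℤ (suc n) f₂ + + 3 * sumℤ (suc n) f₁ + sumℤ (suc n) (λ k → + 1 * U k)
  eq = trans (sym (sumℤ-*ˡ (suc n) (+ 6) (λ k → + suc k * + suc k * U k)))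
    (trans (sumℤ-cong (suc n) (λ k → lemma (+ k) (U k)))
    (trans (sumℤ-+ (suc n) (λ k → + 2 * f₂ k + + 3 * f₁ k) (λ k → + 1 * U k))
    (cong (_+ sumℤ (suc n) (λ k → + 1 * U k))
      (trans (sumℤ-+ (suc n) (λ k → + 2 * f₂ k) (λ k → + 3 * f₁ k))
        (cong₂ _+_ (sumℤ-*ˡ (suc n) (+ 2) f₂) (sumℤ-*ˡ (suc n) (+ 3) f₁))))))

u-slow : ∀ a n → Slow n (u (a * n))
u-slow a n k = divides (- a * u (a * n) k) (trans (u-step (a * n) k) (lemma a n (u (a * n) k)))
  where
  lemma : ∀ a n x → - (a * n) * x ≡ - a * x * n
  lemma = solve-∀

v-slow : ∀ a n → Slow n (v (a * n))
v-slow a n k = *-step-∣ (+ suc k) (u (a * n) k) (u (a * n) (suc k)) (u (- (a * n)) k) (u (- (a * n)) (suc k))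
  (u-slow a n k) (subst (λ t → Slow n (u t)) (sym (ℤP.neg-distribˡ-* a n)) (u-slow (- a) n) k)

∣-from-sum : ∀ {d} g s N t → d ∣ˢ s + N * t → d ∣ˢ g * (N * t) → d ∣ˢ g * s
∣-from-sum {d} g s N t h₁ h₂ = subst (d ∣ˢ_) (lemma g s (N * t)) (ℤ∣.∣m∣n⇒∣m-n (ℤ∣.∣n⇒∣m*n g h₁) h₂)
  where
  lemma : ∀ g s t → g * (s + t) - g * t ≡ g * s
  lemma = solve-∀

-- The 2 contained in g B is spent on T, of which only the double is known to be divisible by n.
∣-even-* : ∀ n g B T → + 2 ∣ˢ g * B → n ∣ˢ + 2 * T → n ∣ˢ g * (B * T)
∣-even-* n g B T (divides q e) h = subst (n ∣ˢ_) eq (ℤ∣.∣n⇒∣m*n q h)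
  where
  lemma : ∀ q T → q * (+ 2 * T) ≡ q * + 2 * T
  lemma = solve-∀
  eq : q * (+ 2 * T) ≡ g * (B * T)
  eq = trans (lemma q T) (trans (cong (_* T) (sym e)) (ℤP.*-assoc g B T))

∣-*-swap : ∀ {n} N g t → n ∣ˢ g * t → N * n ∣ˢ g * (N * t)
∣-*-swap {n} N g t h = subst (N * n ∣ˢ_) (lemma N g t) (ℤ∣.*-monoʳ-∣ N h)
  where
  lemma : ∀ N g t → N * (g * t) ≡ g * (N * t)
  lemma = solve-∀

-- Congruences modulo n, n² and n³ for fixed a₁, ..., a_m and n

module FixedModulus (m : ℕ) (a : Fin m → ℤ) (n′ : ℕ) where
  n = + suc n′

  U V : ℕ → ℤ
  U k = prodFin m (λ i → u (a i * n) k)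
  V k = prodFin m (λ i → v (a i * n) k)

  s g : ℤ
  s = sumFin m a
  g = gcd (s - + 1) (+ 2)

  U-slow : Slow n U
  U-slow k = prodFin-step-∣ (+ suc k) m _ _ (λ i → u-slow (a i) n k)

  V-slow : Slow n V
  V-slow k = prodFin-step-∣ (+ suc k) m _ _ (λ i → v-slow (a i) n k)

  -- Coefficients of the leading terms of the increments of U, in n, and of V, in n².
  B₁ B₂ : ℤ
  B₁ = sumFin m (λ i → - a i)
  B₂ = sumFin m (λ i → - (a i * a i))

  B₁-even : + 2 ∣ˢ g * B₁
  B₁-even = 2∣gcd*s s B₁ (sumFin-even m a _ (λ i → divides (+ 0) (ℤP.+-inverseʳ (a i))))

  B₂-even : + 2 ∣ˢ g * B₂
  B₂-even = 2∣gcd*s s B₂ (sumFin-even m a _ (λ i → even (a i)))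
    where
    lemma₁ : ∀ a → a * (+ 1 - a) ≡ a + - (a * a)
    lemma₁ = solve-∀
    lemma₂ : ∀ a → (a - + 1) * - a ≡ a + - (a * a)
    lemma₂ = solve-∀
    even : ∀ a → + 2 ∣ˢ a + - (a * a)
    even a with parity a
    ... | inj₁ e = subst (+ 2 ∣ˢ_) (lemma₁ a) (ℤ∣.∣m⇒∣m*n (+ 1 - a) e)
    ... | inj₂ o = subst (+ 2 ∣ˢ_) (lemma₂ a) (ℤ∣.∣m⇒∣m*n (- a) o)

  u-linear : ∀ k i → + suc k * (u (a i * n) (suc k) - u (a i * n) k) ≡ n * (- a i * u (a i * n) k)
  u-linear k i = trans (u-step (a i * n) k) (lemma (a i) n (u (a i * n) k))
    where
    lemma : ∀ a n x → - (a * n) * x ≡ n * (- a * x)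
    lemma = solve-∀

  v-linear : ∀ k i → + suc k * + suc k * (v (a i * n) (suc k) - v (a i * n) k) ≡ n * n * (- (a i * a i) * v (a i * n) k)
  v-linear k i = trans (v-step (a i * n) k) (lemma (a i) n (v (a i * n) k))
    where
    lemma : ∀ a n x → - (a * n * (a * n)) * x ≡ n * n * (- (a * a) * x)
    lemma = solve-∀

  U-linear : ∀ k → n * n ∣ˢ + suc k * + suc k * (U (suc k) - U k) - n * (+ suc k * B₁ * U k)
  U-linear k = prodFin-step-linear (+ suc k) (+ suc k) n n m _ _ _ (u-linear k) (λ i → u-slow (a i) n k)

  -- The exact increment of each factor needs the weight (k + 1)², and making the later factors
  -- constant modulo n costs one more k + 1; the resulting cube is the antidifference of w₂ at k +
  -- 1.
  V-linear : ∀ k → n * n * n ∣ˢ + suc k * (+ suc k * + suc k) * (V (suc k) - V k) - n * n * (+ suc k * B₂ * V k)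
  V-linear k = prodFin-step-linear (+ suc k) (+ suc k * + suc k) n (n * n) m _ _ _ (v-linear k) (λ i → v-slow (a i) n k)

  V-square : ∀ k → n * n ∣ˢ + suc k * + suc k * (V (suc k) - V k)
  V-square k = prodFin-step-∣ (+ suc k * + suc k) m _ _
    (λ i → divides (- (a i * a i) * v (a i * n) k) (trans (v-linear k i) (ℤP.*-comm (n * n) (- (a i * a i) * v (a i * n) k))))

  sum-factor : ∀ B (X : ℕ → ℤ) (h : ℕ → ℤ) → sumℤ n′ (λ k → h k * B * X k) ≡ B * sumℤ n′ (λ k → h k * X k)
  sum-factor B X h = trans (sumℤ-cong n′ (λ k → lemma (h k) B (X k))) (sumℤ-*ˡ n′ B (λ k → h k * X k))
    where
    lemma : ∀ h B x → h * B * x ≡ B * (h * x)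
    lemma = solve-∀

  -- Modulo n² the boundary term n² vanishes and the remainder is n B₁ Σ (k + 1) U_k, where g B₁ is
  -- even.
  sum-w₁-U : n * n ∣ˢ g * sumℤ (suc n′) (λ k → w₁ k * U k)
  sum-w₁-U = ∣-from-sum g (sumℤ (suc n′) (λ k → w₁ k * U k)) n _
    (∣-sumℤ-by-parts-linear n w₁ (λ k → + k * + k) (λ k → + suc k * B₁) U n′ (λ k → lemma (+ k)) refl ℤ∣.∣-refl U-linear)
    (∣-*-swap n g _ (subst (λ t → n ∣ˢ g * t) (sym (sum-factor B₁ U (λ k → + suc k)))
      (∣-even-* n g B₁ _ B₁-even (2*sum-suc U U-slow))))
    where
    lemma : ∀ k → (+ 1 + k) * (+ 1 + k) - k * k ≡ + 2 * k + + 1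
    lemma = solve-∀

  Δcube : ∀ k → (+ 1 + k) * ((+ 1 + k) * (+ 1 + k)) - k * (k * k) ≡ + 3 * (k * (k * + 1)) + + 3 * k + + 1
  Δcube = solve-∀

  sum-w₂-U : n * n ∣ˢ + 6 * sumℤ (suc n′) (λ k → w₂ k * U k)
  sum-w₂-U = ∣-from-sum (+ 6) (sumℤ (suc n′) (λ k → w₂ k * U k)) n _
    (∣-sumℤ-by-parts-linear n w₂ (λ k → + k * (+ k * + k)) (λ k → + suc k * + suc k * B₁) U n′ (λ k → Δcube (+ k)) refl
      (ℤ∣.∣n⇒∣m*n n ℤ∣.∣-refl)
      -- `U-linear` has weight (k + 1)², but the antidifference here is a cube. The missing factor k
      -- + 1 also enters the linear term, which becomes (k + 1)² B₁ U_k and so calls for the 6.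
      (λ k → subst (n * n ∣ˢ_) (lemma₁ (+ suc k) (U (suc k)) (U k) n B₁) (ℤ∣.∣n⇒∣m*n (+ suc k) (U-linear k))))
    (∣-*-swap n (+ 6) _ (subst (λ t → n ∣ˢ + 6 * t) (sym (sum-factor B₁ U (λ k → + suc k * + suc k)))
      (subst (n ∣ˢ_) (lemma₂ B₁ (sumℤ n′ (λ k → + suc k * + suc k * U k))) (ℤ∣.∣n⇒∣m*n B₁ (6*sum-suc² U U-slow)))))
    where
    lemma₁ : ∀ k y x n B → k * (k * k * (y - x) - n * (k * B * x)) ≡ k * (k * k) * (y - x) - n * (k * k * B * x)
    lemma₁ = solve-∀
    lemma₂ : ∀ B t → B * (+ 6 * t) ≡ + 6 * (B * t)
    lemma₂ = solve-∀

  -- The antidifference is divisible by k², and (k + 1)² times an increment of V is already a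
  -- multiple of n², so no linear term has to be followed.
  sum-w₃-V : n * n ∣ˢ sumℤ (suc n′) (λ k → sign k * w₃ k * V k)
  sum-w₃-V = ∣-sumℤ-by-parts (λ k → sign k * w₃ k) G V n′ (λ k → lemma₁ (sign k) (+ k)) refl
    (divides (- (sign (suc n′) * (+ 2 * n - + 3))) (lemma₂ (sign (suc n′)) n))
    (λ k → subst (n * n ∣ˢ_) (lemma₃ (sign (suc k)) (+ suc k) (V (suc k) - V k))
      (ℤ∣.∣n⇒∣m*n (- (sign (suc k) * (+ 2 * + suc k - + 3))) (V-square k)))
    where
    G : ℕ → ℤ
    G k = - (sign k * (+ k * + k * (+ 2 * + k - + 3)))
    lemma₁ : ∀ s k → - (-[1+ 0 ] * s * ((+ 1 + k) * (+ 1 + k) * (+ 2 * (+ 1 + k) - + 3))) - - (s * (k * k * (+ 2 * k - + 3)))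
                     ≡ s * (+ 4 * (k * (k * (k * + 1))) - + 1)
    lemma₁ = solve-∀
    lemma₂ : ∀ s n → - (s * (n * n * (+ 2 * n - + 3))) ≡ - (s * (+ 2 * n - + 3)) * (n * n)
    lemma₂ = solve-∀
    lemma₃ : ∀ s k d → - (s * (+ 2 * k - + 3)) * (k * k * d) ≡ - (s * (k * k * (+ 2 * k - + 3))) * d
    lemma₃ = solve-∀

  sum-w₂-V : n * n * n ∣ˢ g * sumℤ (suc n′) (λ k → w₂ k * V k)
  sum-w₂-V = ∣-from-sum g (sumℤ (suc n′) (λ k → w₂ k * V k)) (n * n) _
    (∣-sumℤ-by-parts-linear (n * n) w₂ (λ k → + k * (+ k * + k)) (λ k → + suc k * B₂) V n′ (λ k → Δcube (+ k)) refl
      (divides (+ 1) (lemma n)) V-linear)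
    (∣-*-swap (n * n) g _ (subst (λ t → n ∣ˢ g * t) (sym (sum-factor B₂ V (λ k → + suc k)))
      (∣-even-* n g B₂ _ B₂-even (2*sum-suc V V-slow))))
    where
    lemma : ∀ n → n * (n * n) ≡ + 1 * (n * n * n)
    lemma = solve-∀

  P R : ℕ → ℤ
  P k = prodFin m (λ i → binom (a i * n - + 1) k)
  R k = prodFin m (λ i → binom (a i * n - + 1) k * binom (- (a i * n) - + 1) k)

  sign^m : ∀ k → sign k ^ m ≡ -[1+ 0 ] ^ (k N.* m)
  sign^m k = ℤP.^-*-assoc -[1+ 0 ] k m

  sign-P : ∀ k → -[1+ 0 ] ^ (k N.* m) * P k ≡ U k
  sign-P k = trans (cong (_* P k) (sym (sign^m k))) (sym (prodFin-scale m (sign k) (λ i → binom (a i * n - + 1) k)))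

  R≡V : ∀ k → R k ≡ V k
  R≡V k = prodFin-cong m (λ i → sym (v-binom (a i * n) k))

  sign-weight-P : ∀ (w : ℕ → ℤ) k → -[1+ 0 ] ^ (k N.* m) * w k * P k ≡ w k * U k
  sign-weight-P w k = trans (lemma (-[1+ 0 ] ^ (k N.* m)) (w k) (P k)) (cong (w k *_) (sign-P k))
    where
    lemma : ∀ s w p → s * w * p ≡ w * (s * p)
    lemma = solve-∀

  -- U contains the sign (-1)^(km), so passing from P to U exchanges the unit ε for ε (-1)^m; either
  -- choice of sign in the theorem can therefore lead to either case of `^-unit-sum`.
  unit-weight-P : ∀ ε (w : ℕ → ℤ) k → (ε * sign m) ^ k * w k * U k ≡ ε ^ k * w k * P k
  unit-weight-P ε w k = begin
    (ε * sign m) ^ k * w k * U k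
      ≡⟨ cong₂ (λ s t → s * w k * t) (^-distribʳ-* ε (sign m) k) (sym (sign-P k)) ⟩
    ε ^ k * sign m ^ k * w k * (-[1+ 0 ] ^ (k N.* m) * P k)
      ≡⟨ cong (λ t → ε ^ k * t * w k * (-[1+ 0 ] ^ (k N.* m) * P k)) (trans (ℤP.^-*-assoc -[1+ 0 ] m k) (cong sign (ℕP.*-comm m k))) ⟩
    ε ^ k * σ * w k * (σ * P k)
      ≡⟨ lemma (ε ^ k) σ (w k) (P k) ⟩
    σ * σ * (ε ^ k * w k * P k)
      ≡⟨ cong (_* (ε ^ k * w k * P k)) (sign² (k N.* m)) ⟩
    + 1 * (ε ^ k * w k * P k)
      ≡⟨ ℤP.*-identityˡ _ ⟩
    ε ^ k * w k * P k ∎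
    where
    open ≡-Reasoning
    σ = -[1+ 0 ] ^ (k N.* m)
    lemma : ∀ e s w p → e * s * w * (s * p) ≡ s * s * (e * w * p)
    lemma = solve-∀

  unit-sum-w₁-P : ∀ ε → ε ≡ + 1 ⊎ ε ≡ -[1+ 0 ] → n ∣ˢ sumℤ (suc n′) (λ k → ε ^ k * w₁ k * P k)
  unit-sum-w₁-P ε ε=±1 = subst (n ∣ˢ_) (sumℤ-cong (suc n′) (unit-weight-P ε w₁))
    (unit-sum-w₁ (ε * sign m) (unit-* ε=±1 (sign-unit m)) U U-slow)

  unit-sum-w₃-P : ∀ ε → ε ≡ + 1 ⊎ ε ≡ -[1+ 0 ] → n ∣ˢ sumℤ (suc n′) (λ k → ε ^ k * w₃ k * P k)
  unit-sum-w₃-P ε ε=±1 = subst (n ∣ˢ_) (sumℤ-cong (suc n′) (unit-weight-P ε w₃))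
    (unit-sum-w₃ (ε * sign m) (unit-* ε=±1 (sign-unit m)) U U-slow)

  n² : n ^ 2 ≡ n * n
  n² = cong (n *_) (ℤP.*-identityʳ n)

  n³ : n ^ 3 ≡ n * n * n
  n³ = trans (cong (n *_) n²) (sym (ℤP.*-assoc n n n))

  sum-w₁-P : n ^ 2 ∣ˢ g * sumℤ (suc n′) (λ k → -[1+ 0 ] ^ (k N.* m) * w₁ k * P k)
  sum-w₁-P = subst₂ (λ d t → d ∣ˢ g * t) (sym n²) (sym (sumℤ-cong (suc n′) (sign-weight-P w₁))) sum-w₁-U

  sum-w₂-P : n ^ 2 ∣ˢ + 6 * sumℤ (suc n′) (λ k → -[1+ 0 ] ^ (k N.* m) * w₂ k * P k)
  sum-w₂-P = subst₂ (λ d t → d ∣ˢ + 6 * t) (sym n²) (sym (sumℤ-cong (suc n′) (sign-weight-P w₂))) sum-w₂-U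

  sum-w₃-R : n ^ 2 ∣ˢ sumℤ (suc n′) (λ k → sign k * w₃ k * R k)
  sum-w₃-R = subst₂ _∣ˢ_ (sym n²) (sym (sumℤ-cong (suc n′) (λ k → cong (sign k * w₃ k *_) (R≡V k)))) sum-w₃-V

  sum-w₂-R : n ^ 3 ∣ˢ g * sumℤ (suc n′) (λ k → w₂ k * R k)
  sum-w₂-R = subst₂ (λ d t → d ∣ˢ g * t) (sym n³) (sym (sumℤ-cong (suc n′) (λ k → cong (w₂ k *_) (R≡V k)))) sum-w₂-V

-- Rational fractions and telescoping

toℚᵘ-toℚ : ∀ z → toℚᵘ (toℚ z) ℚᵘ.≃ ℚᵘ.mkℚᵘ z 0
toℚᵘ-toℚ z = ℚP.toℚᵘ-fromℚᵘ (ℚᵘ.mkℚᵘ z 0)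

toℚ-+ : ∀ x y → toℚ (x + y) ≡ toℚ x Q.+ toℚ y
toℚ-+ x y = ℚP.toℚᵘ-injective (begin
  toℚᵘ (toℚ (x + y))                 ≈⟨ toℚᵘ-toℚ (x + y) ⟩
  ℚᵘ.mkℚᵘ (x + y) 0                  ≈⟨ ℚᵘ.*≡* (lemma x y) ⟩
  ℚᵘ.mkℚᵘ x 0 ℚᵘ.+ ℚᵘ.mkℚᵘ y 0       ≈⟨ ℚᵘP.+-cong (toℚᵘ-toℚ x) (toℚᵘ-toℚ y) ⟨
  toℚᵘ (toℚ x) ℚᵘ.+ toℚᵘ (toℚ y)     ≈⟨ ℚP.toℚᵘ-homo-+ (toℚ x) (toℚ y) ⟨
  toℚᵘ (toℚ x Q.+ toℚ y)             ∎)
  where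
  open ℚᵘP.≃-Reasoning
  lemma : ∀ x y → (x + y) * + 1 ≡ (x * + 1 + y * + 1) * + 1
  lemma = solve-∀

toℚ-* : ∀ x y → toℚ (x * y) ≡ toℚ x Q.* toℚ y
toℚ-* x y = ℚP.toℚᵘ-injective (begin
  toℚᵘ (toℚ (x * y))                 ≈⟨ toℚᵘ-toℚ (x * y) ⟩
  ℚᵘ.mkℚᵘ x 0 ℚᵘ.* ℚᵘ.mkℚᵘ y 0       ≈⟨ ℚᵘP.*-cong (toℚᵘ-toℚ x) (toℚᵘ-toℚ y) ⟨
  toℚᵘ (toℚ x) ℚᵘ.* toℚᵘ (toℚ y)     ≈⟨ ℚP.toℚᵘ-homo-* (toℚ x) (toℚ y) ⟨
  toℚᵘ (toℚ x Q.* toℚ y)             ∎)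
  where open ℚᵘP.≃-Reasoning

toℚ-neg : ∀ x → toℚ (- x) ≡ Q.- toℚ x
toℚ-neg x = ℚP.toℚᵘ-injective (begin
  toℚᵘ (toℚ (- x))                   ≈⟨ toℚᵘ-toℚ (- x) ⟩
  ℚᵘ.- ℚᵘ.mkℚᵘ x 0                   ≈⟨ ℚᵘP.-‿cong (toℚᵘ-toℚ x) ⟨
  ℚᵘ.- toℚᵘ (toℚ x)                  ≈⟨ ℚP.toℚᵘ-homo‿- (toℚ x) ⟨
  toℚᵘ (Q.- toℚ x)                   ∎)
  where open ℚᵘP.≃-Reasoning

toℚ-- : ∀ x y → toℚ (x - y) ≡ toℚ x Q.- toℚ y
toℚ-- x y = trans (toℚ-+ x (- y)) (cong (toℚ x Q.+_) (toℚ-neg y))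

inv : ℤ → ℚ
inv d = 1ℚ ÷ℤ d

÷ℤ-inv : ∀ x d → x ÷ℤ d ≡ x Q.* inv d
÷ℤ-inv x (+ zero)  = sym (ℚP.*-zeroʳ x)
÷ℤ-inv x (+ suc m) = cong (x Q.*_) (sym (ℚP.*-identityˡ _))
÷ℤ-inv x -[1+ m ]  = cong (x Q.*_) (sym (ℚP.*-identityˡ _))

inv-inverseˡ : ∀ d → d ≢ + 0 → inv d Q.* toℚ d ≡ 1ℚ
inv-inverseˡ (+ zero)  d≢0 = ⊥-elim (d≢0 refl)
inv-inverseˡ (+ suc m) _ =
  trans (cong (Q._* toℚ (+ suc m)) (ℚP.*-identityˡ (+ 1 Q./ suc m))) (ℚP.toℚᵘ-injective (begin
  toℚᵘ ((+ 1 Q./ suc m) Q.* toℚ (+ suc m))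
    ≈⟨ ℚP.toℚᵘ-homo-* (+ 1 Q./ suc m) (toℚ (+ suc m)) ⟩
  toℚᵘ (+ 1 Q./ suc m) ℚᵘ.* toℚᵘ (toℚ (+ suc m))
    ≈⟨ ℚᵘP.*-cong (ℚP.toℚᵘ-fromℚᵘ (ℚᵘ.mkℚᵘ (+ 1) m)) (toℚᵘ-toℚ (+ suc m)) ⟩
  ℚᵘ.mkℚᵘ (+ 1) m ℚᵘ.* ℚᵘ.mkℚᵘ (+ suc m) 0
    ≈⟨ ℚᵘ.*≡* (ℤP.*-assoc (+ 1) (+ suc m) (+ 1)) ⟩
  toℚᵘ 1ℚ ∎))
  where open ℚᵘP.≃-Reasoning
inv-inverseˡ -[1+ m ] _ =
  trans (cong (Q._* toℚ -[1+ m ]) (ℚP.*-identityˡ (-[1+ 0 ] Q./ suc m))) (ℚP.toℚᵘ-injective (begin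
  toℚᵘ ((-[1+ 0 ] Q./ suc m) Q.* toℚ -[1+ m ])
    ≈⟨ ℚP.toℚᵘ-homo-* (-[1+ 0 ] Q./ suc m) (toℚ -[1+ m ]) ⟩
  toℚᵘ (-[1+ 0 ] Q./ suc m) ℚᵘ.* toℚᵘ (toℚ -[1+ m ])
    ≈⟨ ℚᵘP.*-cong (ℚP.toℚᵘ-fromℚᵘ (ℚᵘ.mkℚᵘ -[1+ 0 ] m)) (toℚᵘ-toℚ -[1+ m ]) ⟩
  ℚᵘ.mkℚᵘ -[1+ 0 ] m ℚᵘ.* ℚᵘ.mkℚᵘ -[1+ m ] 0
    ≈⟨ ℚᵘ.*≡* (lemma (+ suc m)) ⟩
  toℚᵘ 1ℚ ∎))
  where
  open ℚᵘP.≃-Reasoning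
  lemma : ∀ x → (- + 1 * (- x)) * + 1 ≡ + 1 * (x * + 1)
  lemma = solve-∀

-- One notion for both kinds of claim in part (ii): d = 1 means integrality, d = n integrality after
-- division by n.
IsMultiple : ℤ → ℚ → Set
IsMultiple d x = ∃ λ z → x ≡ toℚ (z * d)

isMultiple-+ : ∀ {d x y} → IsMultiple d x → IsMultiple d y → IsMultiple d (x Q.+ y)
isMultiple-+ {d} (z , refl) (w , refl) =
  z + w , sym (trans (cong toℚ (ℤP.*-distribʳ-+ d z w)) (toℚ-+ (z * d) (w * d)))

isMultiple-- : ∀ {d x y} → IsMultiple d x → IsMultiple d y → IsMultiple d (x Q.- y)
isMultiple-- {d} (z , refl) (w , refl) =
  z - w , sym (trans (cong toℚ (lemma z w d)) (toℚ-- (z * d) (w * d)))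
  where
  lemma : ∀ z w d → (z - w) * d ≡ z * d - w * d
  lemma = solve-∀

module _ where
  open +-*-Solver using (solve; con; _:*_; _:+_; _:-_; _:=_)

  isMultiple-fraction : ∀ {d} p q y → q ≢ + 0 → (q * d) ∣ˢ (p * y) →
                        IsMultiple d (toℚ p Q.* inv q Q.* toℚ y)
  isMultiple-fraction {d} p q y q≢0 (divides z eq) = z , (begin
    toℚ p Q.* inv q Q.* toℚ y           ≡⟨ solve 3 (λ p i y → p :* i :* y := p :* y :* i) refl (toℚ p) (inv q) (toℚ y) ⟩
    toℚ p Q.* toℚ y Q.* inv q           ≡⟨ cong (Q._* inv q) (toℚ-* p y) ⟨
    toℚ (p * y) Q.* inv q               ≡⟨ cong (λ t → toℚ t Q.* inv q) (trans eq (lemma z q d)) ⟩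
    toℚ (z * d * q) Q.* inv q           ≡⟨ cong (Q._* inv q) (toℚ-* (z * d) q) ⟩
    toℚ (z * d) Q.* toℚ q Q.* inv q     ≡⟨ ℚP.*-assoc (toℚ (z * d)) (toℚ q) (inv q) ⟩
    toℚ (z * d) Q.* (toℚ q Q.* inv q)   ≡⟨ cong (toℚ (z * d) Q.*_) (trans (ℚP.*-comm (toℚ q) (inv q)) (inv-inverseˡ q q≢0)) ⟩
    toℚ (z * d) Q.* 1ℚ                  ≡⟨ ℚP.*-identityʳ _ ⟩
    toℚ (z * d)                         ∎)
    where
    open ≡-Reasoning
    lemma : ∀ z q d → z * (q * d) ≡ z * d * q
    lemma = solve-∀

  fraction-difference : ∀ N D p₀ q₀ p₁ q₁ → D ≢ + 0 → q₀ ≢ + 0 → q₁ ≢ + 0 →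
    (p₁ * q₀ - p₀ * q₁) * D ≡ N * (q₀ * q₁) → ∀ y →
    toℚ (N * y) ÷ℤ D ≡ (toℚ p₁ Q.* inv q₁ Q.- toℚ p₀ Q.* inv q₀) Q.* toℚ y
  fraction-difference N D p₀ q₀ p₁ q₁ D≢0 q₀≢0 q₁≢0 eq y = begin
    toℚ (N * y) ÷ℤ D
      ≡⟨ trans (÷ℤ-inv (toℚ (N * y)) D) (cong (Q._* iD) (toℚ-* N y)) ⟩
    toℚ N Q.* toℚ y Q.* iD
      ≡⟨ solve 3 (λ n y d → n :* y :* d := n :* (con 1ℚ :* con 1ℚ) :* d :* y) refl (toℚ N) (toℚ y) iD ⟩
    toℚ N Q.* (1ℚ Q.* 1ℚ) Q.* iD Q.* toℚ y
      -- Insert 1 = (i₀ q₀)(i₁ q₁), so that the product q₀ q₁ required by the cross-multiplied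
      -- hypothesis appears.
      ≡⟨ cong₂ (λ s t → toℚ N Q.* (s Q.* t) Q.* iD Q.* toℚ y) (inv-inverseˡ q₀ q₀≢0) (inv-inverseˡ q₁ q₁≢0) ⟨
    toℚ N Q.* (i₀ Q.* toℚ q₀ Q.* (i₁ Q.* toℚ q₁)) Q.* iD Q.* toℚ y
      ≡⟨ solve 7 (λ n i₀ q₀ i₁ q₁ d y → n :* (i₀ :* q₀ :* (i₁ :* q₁)) :* d :* y := n :* (q₀ :* q₁) :* (i₀ :* i₁ :* d :* y))
           refl (toℚ N) i₀ (toℚ q₀) i₁ (toℚ q₁) iD (toℚ y) ⟩
    toℚ N Q.* (toℚ q₀ Q.* toℚ q₁) Q.* (i₀ Q.* i₁ Q.* iD Q.* toℚ y)
      ≡⟨ cong (Q._* (i₀ Q.* i₁ Q.* iD Q.* toℚ y)) eqℚ ⟨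
    (toℚ p₁ Q.* toℚ q₀ Q.- toℚ p₀ Q.* toℚ q₁) Q.* toℚ D Q.* (i₀ Q.* i₁ Q.* iD Q.* toℚ y)
      ≡⟨ solve 9 (λ p₁ q₀ p₀ q₁ D i₀ i₁ d y →
           (p₁ :* q₀ :- p₀ :* q₁) :* D :* (i₀ :* i₁ :* d :* y) :=
           (p₁ :* i₁ :* (i₀ :* q₀) :- p₀ :* i₀ :* (i₁ :* q₁)) :* (d :* D) :* y)
           refl (toℚ p₁) (toℚ q₀) (toℚ p₀) (toℚ q₁) (toℚ D) i₀ i₁ iD (toℚ y) ⟩
    (toℚ p₁ Q.* i₁ Q.* (i₀ Q.* toℚ q₀) Q.- toℚ p₀ Q.* i₀ Q.* (i₁ Q.* toℚ q₁)) Q.* (iD Q.* toℚ D) Q.* toℚ y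
      ≡⟨ cong₂ (λ s t → (toℚ p₁ Q.* i₁ Q.* s Q.- toℚ p₀ Q.* i₀ Q.* t) Q.* (iD Q.* toℚ D) Q.* toℚ y) (inv-inverseˡ q₀ q₀≢0) (inv-inverseˡ q₁ q₁≢0) ⟩
    (toℚ p₁ Q.* i₁ Q.* 1ℚ Q.- toℚ p₀ Q.* i₀ Q.* 1ℚ) Q.* (iD Q.* toℚ D) Q.* toℚ y
      ≡⟨ cong (λ s → (toℚ p₁ Q.* i₁ Q.* 1ℚ Q.- toℚ p₀ Q.* i₀ Q.* 1ℚ) Q.* s Q.* toℚ y) (inv-inverseˡ D D≢0) ⟩
    (toℚ p₁ Q.* i₁ Q.* 1ℚ Q.- toℚ p₀ Q.* i₀ Q.* 1ℚ) Q.* 1ℚ Q.* toℚ y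
      ≡⟨ solve 3 (λ a b y → (a :* con 1ℚ :- b :* con 1ℚ) :* con 1ℚ :* y := (a :- b) :* y) refl (toℚ p₁ Q.* i₁) (toℚ p₀ Q.* i₀) (toℚ y) ⟩
    (toℚ p₁ Q.* i₁ Q.- toℚ p₀ Q.* i₀) Q.* toℚ y ∎
    where
    open ≡-Reasoning
    i₀ = inv q₀
    i₁ = inv q₁
    iD = inv D
    eqℚ : (toℚ p₁ Q.* toℚ q₀ Q.- toℚ p₀ Q.* toℚ q₁) Q.* toℚ D ≡ toℚ N Q.* (toℚ q₀ Q.* toℚ q₁)
    eqℚ = begin
      (toℚ p₁ Q.* toℚ q₀ Q.- toℚ p₀ Q.* toℚ q₁) Q.* toℚ D
        ≡⟨ cong₂ (λ s t → (s Q.- t) Q.* toℚ D) (toℚ-* p₁ q₀) (toℚ-* p₀ q₁) ⟨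
      (toℚ (p₁ * q₀) Q.- toℚ (p₀ * q₁)) Q.* toℚ D
        ≡⟨ cong (Q._* toℚ D) (toℚ-- (p₁ * q₀) (p₀ * q₁)) ⟨
      toℚ (p₁ * q₀ - p₀ * q₁) Q.* toℚ D
        ≡⟨ toℚ-* (p₁ * q₀ - p₀ * q₁) D ⟨
      toℚ ((p₁ * q₀ - p₀ * q₁) * D)
        ≡⟨ cong toℚ eq ⟩
      toℚ (N * (q₀ * q₁))
        ≡⟨ trans (toℚ-* N (q₀ * q₁)) (cong (toℚ N Q.*_) (toℚ-* q₀ q₁)) ⟩
      toℚ N Q.* (toℚ q₀ Q.* toℚ q₁) ∎

sumℚ-cong : ∀ n {f g : ℕ → ℚ} → (∀ k → f k ≡ g k) → sumℚ n f ≡ sumℚ n g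
sumℚ-cong zero    f≗g = refl
sumℚ-cong (suc n) f≗g = cong₂ Q._+_ (sumℚ-cong n f≗g) (f≗g n)

sumℚ-*ˡ : ∀ n c (f : ℕ → ℚ) → sumℚ n (λ k → c Q.* f k) ≡ c Q.* sumℚ n f
sumℚ-*ˡ zero    c f = sym (ℚP.*-zeroʳ c)
sumℚ-*ˡ (suc n) c f = trans (cong (Q._+ c Q.* f n) (sumℚ-*ˡ n c f)) (sym (ℚP.*-distribˡ-+ c (sumℚ n f) (f n)))

isMultiple⇒isInt : ∀ {x} → IsMultiple (+ 1) x → IsInt x
isMultiple⇒isInt (z , refl) = z * + 1 , refl

isMultiple⇒isInt-÷ : ∀ {d x} → d ≢ + 0 → IsMultiple d x → IsInt (x ÷ℤ d)
isMultiple⇒isInt-÷ {d} d≢0 (z , refl) = z , (begin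
  toℚ (z * d) ÷ℤ d                 ≡⟨ ÷ℤ-inv (toℚ (z * d)) d ⟩
  toℚ (z * d) Q.* inv d            ≡⟨ cong (Q._* inv d) (toℚ-* z d) ⟩
  toℚ z Q.* toℚ d Q.* inv d        ≡⟨ ℚP.*-assoc (toℚ z) (toℚ d) (inv d) ⟩
  toℚ z Q.* (toℚ d Q.* inv d)      ≡⟨ cong (toℚ z Q.*_) (trans (ℚP.*-comm (toℚ d) (inv d)) (inv-inverseˡ d d≢0)) ⟩
  toℚ z Q.* 1ℚ                     ≡⟨ ℚP.*-identityʳ (toℚ z) ⟩
  toℚ z                            ∎)
  where open ≡-Reasoning

÷ℤ-combine : ∀ x y s D → D ≢ + 0 → toℚ s Q.* (toℚ x Q.+ toℚ y ÷ℤ D) ≡ toℚ (s * (x * D + y)) ÷ℤ D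
÷ℤ-combine x y s D D≢0 = sym (begin
  toℚ (s * (x * D + y)) ÷ℤ D
    ≡⟨ ÷ℤ-inv (toℚ (s * (x * D + y))) D ⟩
  toℚ (s * (x * D + y)) Q.* inv D
    ≡⟨ cong (Q._* inv D) (trans (toℚ-* s (x * D + y)) (cong (toℚ s Q.*_) (trans (toℚ-+ (x * D) y) (cong (Q._+ toℚ y) (toℚ-* x D))))) ⟩
  toℚ s Q.* (toℚ x Q.* toℚ D Q.+ toℚ y) Q.* inv D
    ≡⟨ solve 5 (λ s x d y i → s :* (x :* d :+ y) :* i := s :* (x :* (i :* d) :+ y :* i)) refl (toℚ s) (toℚ x) (toℚ D) (toℚ y) (inv D) ⟩
  toℚ s Q.* (toℚ x Q.* (inv D Q.* toℚ D) Q.+ toℚ y Q.* inv D)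
    ≡⟨ cong₂ (λ t u → toℚ s Q.* (t Q.+ u)) (trans (cong (toℚ x Q.*_) (inv-inverseˡ D D≢0)) (ℚP.*-identityʳ (toℚ x))) (sym (÷ℤ-inv (toℚ y) D)) ⟩
  toℚ s Q.* (toℚ x Q.+ toℚ y ÷ℤ D) ∎)
  where
  open ≡-Reasoning
  open +-*-Solver using (solve; _:*_; _:+_; _:=_)

-- Summation by parts with the rational antidifference G = p/q. Here G 0 may be nonzero, as it is
-- for -(-1)^k/(2k - 1), so the lower boundary term has its own hypothesis `first`.
module Telescoping
  (p q N D y : ℕ → ℤ) (d : ℤ)
  (D≢0 : ∀ k → D k ≢ + 0) (q≢0 : ∀ k → q k ≢ + 0)
  (cross : ∀ k → (p (suc k) * q k - p k * q (suc k)) * D k ≡ N k * (q k * q (suc k)))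
  (first : (q 0 * d) ∣ˢ (p 0 * y 0))
  (step : ∀ k → (q (suc k) * d) ∣ˢ (p (suc k) * (y (suc k) - y k)))
  where

  G : ℕ → ℚ
  G k = toℚ (p k) Q.* inv (q k)

  partialSum : ℕ → ℚ
  partialSum n = sumℚ n (λ k → toℚ (N k * y k) ÷ℤ D k)

  summand : ∀ k → toℚ (N k * y k) ÷ℤ D k ≡ (G (suc k) Q.- G k) Q.* toℚ (y k)
  summand k = fraction-difference (N k) (D k) (p k) (q k) (p (suc k)) (q (suc k)) (D≢0 k) (q≢0 k) (q≢0 (suc k)) (cross k) (y k)

  -- The upper boundary term is kept out of the induction, because its divisibility is available
  -- only at the final index.
  isMultiple-remainder : ∀ n → IsMultiple d (partialSum (suc n) Q.- G (suc n) Q.* toℚ (y n))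
  isMultiple-remainder zero = subst (IsMultiple d) (sym eq)
    (isMultiple-- (+ 0 , refl) (isMultiple-fraction (p 0) (q 0) (y 0) (q≢0 0) first))
    where
    open +-*-Solver using (solve; _:*_; _:-_; _:+_; con; _:=_)
    eq : partialSum 1 Q.- G 1 Q.* toℚ (y 0) ≡ 0ℚ Q.- G 0 Q.* toℚ (y 0)
    eq = trans (cong (λ t → 0ℚ Q.+ t Q.- G 1 Q.* toℚ (y 0)) (summand 0))
      (solve 3 (λ g₁ g₀ y → con 0ℚ :+ (g₁ :- g₀) :* y :- g₁ :* y := con 0ℚ :- g₀ :* y) refl (G 1) (G 0) (toℚ (y 0)))
  isMultiple-remainder (suc n) = subst (IsMultiple d) (sym eq)
    (isMultiple-- (isMultiple-remainder n) (isMultiple-fraction (p (suc n)) (q (suc n)) (y (suc n) - y n) (q≢0 (suc n)) (step n)))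
    where
    open ≡-Reasoning
    open +-*-Solver using (solve; _:*_; _:-_; _:+_; con; _:=_)
    eq : partialSum (suc (suc n)) Q.- G (suc (suc n)) Q.* toℚ (y (suc n)) ≡
         partialSum (suc n) Q.- G (suc n) Q.* toℚ (y n) Q.- G (suc n) Q.* toℚ (y (suc n) - y n)
    eq = begin
      partialSum (suc n) Q.+ toℚ (N (suc n) * y (suc n)) ÷ℤ D (suc n) Q.- G (suc (suc n)) Q.* toℚ (y (suc n))
        ≡⟨ cong (λ t → partialSum (suc n) Q.+ t Q.- G (suc (suc n)) Q.* toℚ (y (suc n))) (summand (suc n)) ⟩
      partialSum (suc n) Q.+ (G (suc (suc n)) Q.- G (suc n)) Q.* toℚ (y (suc n)) Q.- G (suc (suc n)) Q.* toℚ (y (suc n))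
        ≡⟨ solve 5 (λ s g₂ g₁ y₁ y₀ → s :+ (g₂ :- g₁) :* y₁ :- g₂ :* y₁ := s :- g₁ :* y₀ :- g₁ :* (y₁ :- y₀)) refl
             (partialSum (suc n)) (G (suc (suc n))) (G (suc n)) (toℚ (y (suc n))) (toℚ (y n)) ⟩
      partialSum (suc n) Q.- G (suc n) Q.* toℚ (y n) Q.- G (suc n) Q.* (toℚ (y (suc n)) Q.- toℚ (y n))
        ≡⟨ cong (λ t → partialSum (suc n) Q.- G (suc n) Q.* toℚ (y n) Q.- G (suc n) Q.* t) (toℚ-- (y (suc n)) (y n)) ⟨
      partialSum (suc n) Q.- G (suc n) Q.* toℚ (y n) Q.- G (suc n) Q.* toℚ (y (suc n) - y n) ∎

  isMultiple-sum : ∀ n → (q (suc n) * d) ∣ˢ (p (suc n) * y n) → IsMultiple d (partialSum (suc n))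
  isMultiple-sum n last = subst (IsMultiple d) eq
    (isMultiple-+ (isMultiple-remainder n) (isMultiple-fraction (p (suc n)) (q (suc n)) (y n) (q≢0 (suc n)) last))
    where
    open +-*-Solver using (solve; _:-_; _:+_; _:=_)
    eq : partialSum (suc n) Q.- G (suc n) Q.* toℚ (y n) Q.+ G (suc n) Q.* toℚ (y n) ≡ partialSum (suc n)
    eq = solve 2 (λ s t → s :- t :+ t := s) refl (partialSum (suc n)) (G (suc n) Q.* toℚ (y n))

-- Divisibility by C(2k + 1, k + 1)

centralBinom : ℕ → ℤ
centralBinom k = binom (+ 2 * + k) k

-- centralBinom (k + 1) / 2
halfCentral : ℕ → ℤ
halfCentral k = binom (+ 1 + + 2 * + k) (suc k)

halfCentral-centralBinom : ∀ k → + suc k * halfCentral k ≡ (+ 1 + + 2 * + k) * centralBinom k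
halfCentral-centralBinom k = binom-shift (+ 2 * + k) k

cancel-suc : ∀ k {x y} → + suc k * x ≡ + suc k * y → x ≡ y
cancel-suc k {x} {y} = ℤP.*-cancelˡ-≡ (+ suc k) x y

halfCentral-symmetric : ∀ k → halfCentral k ≡ binom (+ 1 + + 2 * + k) k
halfCentral-symmetric k = cancel-suc k
  (trans (binom-suc (+ 1 + + 2 * + k) k) (cong (_* binom (+ 1 + + 2 * + k) k) (lemma (+ k))))
  where
  lemma : ∀ k → + 1 + + 2 * k - k ≡ + 1 + k
  lemma = solve-∀

centralBinom-suc : ∀ k → centralBinom (suc k) ≡ + 2 * halfCentral k
centralBinom-suc k = cancel-suc k (begin
  + suc k * binom (+ 2 * + suc k) (suc k)              ≡⟨ cong (λ t → + suc k * binom t (suc k)) (lemma₁ (+ k)) ⟩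
  + suc k * binom (+ 1 + (+ 1 + + 2 * + k)) (suc k)    ≡⟨ binom-shift (+ 1 + + 2 * + k) k ⟩
  (+ 1 + (+ 1 + + 2 * + k)) * binom (+ 1 + + 2 * + k) k ≡⟨ cong ((+ 1 + (+ 1 + + 2 * + k)) *_) (halfCentral-symmetric k) ⟨
  (+ 1 + (+ 1 + + 2 * + k)) * halfCentral k            ≡⟨ lemma₂ (+ k) (halfCentral k) ⟩
  + suc k * (+ 2 * halfCentral k)                      ∎)
  where
  open ≡-Reasoning
  lemma₁ : ∀ k → + 2 * (+ 1 + k) ≡ + 1 + (+ 1 + + 2 * k)
  lemma₁ = solve-∀
  lemma₂ : ∀ k c → (+ 1 + (+ 1 + + 2 * k)) * c ≡ (+ 1 + k) * (+ 2 * c)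
  lemma₂ = solve-∀

halfCentral-suc : ∀ k → + suc (suc k) * halfCentral (suc k) ≡ + 2 * (+ 2 * + k + + 3) * halfCentral k
halfCentral-suc k = trans (halfCentral-centralBinom (suc k))
  (trans (cong ((+ 1 + + 2 * + suc k) *_) (centralBinom-suc k)) (lemma (+ k) (halfCentral k)))
  where
  lemma : ∀ k c → (+ 1 + + 2 * (+ 1 + k)) * (+ 2 * c) ≡ + 2 * (+ 2 * k + + 3) * c
  lemma = solve-∀

-- Since (k + 1) c = (2k + 1) C(2k, k) and 2(k + 1) - (2k + 1) = 1, the factor 2k + 1 can be split
-- off from c.
odd∣halfCentral : ∀ k → + 1 + + 2 * + k ∣ˢ halfCentral k
odd∣halfCentral k = divides (+ 2 * centralBinom k - halfCentral k) (begin
  halfCentral k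
    ≡⟨ lemma₁ (+ k) (halfCentral k) ⟩
  + 2 * (+ suc k * halfCentral k) - halfCentral k * (+ 1 + + 2 * + k)
    ≡⟨ cong (λ t → + 2 * t - halfCentral k * (+ 1 + + 2 * + k)) (halfCentral-centralBinom k) ⟩
  + 2 * ((+ 1 + + 2 * + k) * centralBinom k) - halfCentral k * (+ 1 + + 2 * + k)
    ≡⟨ lemma₂ (+ 1 + + 2 * + k) (centralBinom k) (halfCentral k) ⟩
  (+ 2 * centralBinom k - halfCentral k) * (+ 1 + + 2 * + k) ∎)
  where
  open ≡-Reasoning
  lemma₁ : ∀ k c → c ≡ + 2 * ((+ 1 + k) * c) - c * (+ 1 + + 2 * k)
  lemma₁ = solve-∀
  lemma₂ : ∀ a b c → + 2 * (a * b) - c * a ≡ (+ 2 * b - c) * a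
  lemma₂ = solve-∀

-- The quotient is a Catalan number.
suc-suc∣2*halfCentral : ∀ k → + suc (suc k) ∣ˢ + 2 * halfCentral k
suc-suc∣2*halfCentral k = divides (halfCentral k - b) (begin
  + 2 * halfCentral k
    ≡⟨ lemma₁ (+ k) (halfCentral k) ⟩
  halfCentral k * + suc (suc k) - (+ 1 + + 2 * + k - + suc k) * halfCentral k
    ≡⟨ cong (λ t → halfCentral k * + suc (suc k) - t) (binom-suc (+ 1 + + 2 * + k) (suc k)) ⟨
  halfCentral k * + suc (suc k) - + suc (suc k) * b
    ≡⟨ lemma₂ (halfCentral k) (+ suc (suc k)) b ⟩
  (halfCentral k - b) * + suc (suc k) ∎)
  where
  open ≡-Reasoning
  b = binom (+ 1 + + 2 * + k) (suc (suc k))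
  lemma₁ : ∀ k c → + 2 * c ≡ c * (+ 1 + (+ 1 + k)) - (+ 1 + + 2 * k - (+ 1 + k)) * c
  lemma₁ = solve-∀
  lemma₂ : ∀ c a b → c * a - a * b ≡ (c - b) * a
  lemma₂ = solve-∀

-- Written with k * 2 so that the lower index unfolds by two at k + 1.
oddBinom : ℤ → ℕ → ℤ
oddBinom x k = binom (x + + k) (suc (k N.* 2))

k*2 : ∀ k → + (k N.* 2) ≡ + k * + 2
k*2 k = ℤP.pos-* k 2

-- Raising k adds one factor at each end of the falling product, x + k + 1 through `binom-shift` and
-- x - k - 1 through `binom-suc`.
oddBinom-suc : ∀ x k → + 2 * + suc k * (+ 2 * + k + + 3) * oddBinom x (suc k) ≡ (x * x - + suc k * + suc k) * oddBinom x k
oddBinom-suc x k = begin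
  + 2 * + suc k * (+ 2 * + k + + 3) * binom (x + + suc k) (suc (suc (suc j)))
    ≡⟨ cong (λ t → + 2 * + suc k * (+ 2 * + k + + 3) * binom t (suc (suc (suc j)))) (lemma₀ x (+ k)) ⟩
  + 2 * + suc k * (+ 2 * + k + + 3) * binom (+ 1 + y) (suc (suc (suc j)))
    ≡⟨ lemma₁ (+ k) (binom (+ 1 + y) (suc (suc (suc j)))) ⟩
  (+ 2 + + k * + 2) * ((+ 3 + + k * + 2) * binom (+ 1 + y) (suc (suc (suc j))))
    ≡⟨ cong (λ t → (+ 2 + + k * + 2) * ((+ 3 + t) * binom (+ 1 + y) (suc (suc (suc j))))) (k*2 k) ⟨
  (+ 2 + + k * + 2) * (+ suc (suc (suc j)) * binom (+ 1 + y) (suc (suc (suc j))))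
    ≡⟨ cong ((+ 2 + + k * + 2) *_) (binom-shift y (suc (suc j))) ⟩
  (+ 2 + + k * + 2) * ((+ 1 + y) * binom y (suc (suc j)))
    ≡⟨ lemma₂ (+ 2 + + k * + 2) (+ 1 + y) (binom y (suc (suc j))) ⟩
  (+ 1 + y) * ((+ 2 + + k * + 2) * binom y (suc (suc j)))
    ≡⟨ cong (λ t → (+ 1 + y) * ((+ 2 + t) * binom y (suc (suc j)))) (k*2 k) ⟨
  (+ 1 + y) * (+ suc (suc j) * binom y (suc (suc j)))
    ≡⟨ cong ((+ 1 + y) *_) (binom-suc y (suc j)) ⟩
  (+ 1 + y) * ((y - (+ 1 + + j)) * binom y (suc j))
    ≡⟨ cong (λ t → (+ 1 + y) * ((y - (+ 1 + t)) * binom y (suc j))) (k*2 k) ⟩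
  (+ 1 + (x + + k)) * ((x + + k - (+ 1 + + k * + 2)) * binom y (suc j))
    ≡⟨ lemma₃ x (+ k) (binom y (suc j)) ⟩
  (x * x - + suc k * + suc k) * binom y (suc j) ∎
  where
  open ≡-Reasoning
  j = k N.* 2
  y = x + + k
  lemma₀ : ∀ x k → x + (+ 1 + k) ≡ + 1 + (x + k)
  lemma₀ = solve-∀
  lemma₁ : ∀ k b → + 2 * (+ 1 + k) * (+ 2 * k + + 3) * b ≡ (+ 2 + k * + 2) * ((+ 3 + k * + 2) * b)
  lemma₁ = solve-∀
  lemma₂ : ∀ a b c → a * (b * c) ≡ b * (a * c)
  lemma₂ = solve-∀
  lemma₃ : ∀ x k b → (+ 1 + (x + k)) * ((x + k - (+ 1 + k * + 2)) * b) ≡ (x * x - (+ 1 + k) * (+ 1 + k)) * b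
  lemma₃ = solve-∀

-- With y = x + k, the recursions for C(y + 1, 2k + 2) and C(y, 2k + 2) have right-hand coefficients
-- x + k + 1 and x - k - 1. These add up to 2x, so the sum of the two binomials is the quotient.
suc∣x*oddBinom : ∀ x k → + suc k ∣ˢ x * oddBinom x k
suc∣x*oddBinom x k = divides e (ℤP.*-cancelˡ-≡ (+ 2) (x * oddBinom x k) (e * + suc k) (sym (begin
  + 2 * (e * + suc k)
    ≡⟨ lemma₁ (+ k) b₁ b₀ ⟩
  (+ 2 + + k * + 2) * b₁ + (+ 2 + + k * + 2) * b₀
    ≡⟨ cong (λ t → (+ 2 + t) * b₁ + (+ 2 + t) * b₀) (k*2 k) ⟨
  + suc (suc j) * b₁ + + suc (suc j) * b₀
    ≡⟨ cong₂ _+_ (binom-shift y (suc j)) (binom-suc y (suc j)) ⟩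
  (+ 1 + y) * b + (y - (+ 1 + + j)) * b
    ≡⟨ cong (λ t → (+ 1 + y) * b + (y - (+ 1 + t)) * b) (k*2 k) ⟩
  (+ 1 + (x + + k)) * b + (x + + k - (+ 1 + + k * + 2)) * b
    ≡⟨ lemma₂ x (+ k) b ⟩
  + 2 * (x * b) ∎)))
  where
  open ≡-Reasoning
  j = k N.* 2
  y = x + + k
  b = binom y (suc j)
  b₁ = binom (+ 1 + y) (suc (suc j))
  b₀ = binom y (suc (suc j))
  e = b₁ + b₀
  lemma₁ : ∀ k a b → + 2 * ((a + b) * (+ 1 + k)) ≡ (+ 2 + k * + 2) * a + (+ 2 + k * + 2) * b
  lemma₁ = solve-∀
  lemma₂ : ∀ x k b → (+ 1 + (x + k)) * b + (x + k - (+ 1 + k * + 2)) * b ≡ + 2 * (x * b)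
  lemma₂ = solve-∀

-- Both sides have the ratio (K² - x²)/K² with K = k + 1: on the left by `v-step`, on the right by
-- `oddBinom-suc` and `halfCentral-suc`.
x*v : ∀ x k → x * v x k ≡ sign k * + suc k * oddBinom x k * halfCentral k
x*v x zero = begin
  x * v x 0                                ≡⟨⟩
  -- `binom x 1` unfolds to an integer division, so its value x is taken from `binom-suc`.
  x * + 1                                  ≡⟨ lemma x (binom x 1) (trans (sym (ℤP.*-identityˡ (binom x 1))) (trans (binom-suc x 0) (lemma₀ x))) ⟩
  + 1 * + 1 * binom x 1 * + 1              ≡⟨ cong (λ t → + 1 * + 1 * binom t 1 * + 1) (ℤP.+-identityʳ x) ⟨
  + 1 * + 1 * binom (x + + 0) 1 * + 1      ∎
  where
  open ≡-Reasoning
  lemma₀ : ∀ x → (x - + 0) * + 1 ≡ x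
  lemma₀ = solve-∀
  lemma₁ : ∀ x → x * + 1 ≡ + 1 * + 1 * x * + 1
  lemma₁ = solve-∀
  lemma : ∀ x b → b ≡ x → x * + 1 ≡ + 1 * + 1 * b * + 1
  lemma x b refl = lemma₁ x
x*v x (suc k) = cancel-suc k (cancel-suc k (begin
  K * (K * (x * v x (suc k)))
    ≡⟨ lemma₁ K x (v x (suc k)) (v x k) ⟩
  x * (K * K * (v x (suc k) - v x k)) + K * K * (x * v x k)
    ≡⟨ cong (λ t → x * t + K * K * (x * v x k)) (v-step x k) ⟩
  x * (- (x * x) * v x k) + K * K * (x * v x k)
    ≡⟨ lemma₂ K x (v x k) ⟩
  (K * K - x * x) * (x * v x k)
    ≡⟨ cong ((K * K - x * x) *_) (x*v x k) ⟩
  (K * K - x * x) * (s * K * p * c)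
    ≡⟨ lemma₃ K x s p c ⟩
  - s * K * c * ((x * x - K * K) * p)
    ≡⟨ cong (- s * K * c *_) (oddBinom-suc x k) ⟨
  - s * K * c * (+ 2 * K * (+ 2 * + k + + 3) * p′)
    ≡⟨ lemma₄ K (+ k) s p′ c ⟩
  - s * K * K * p′ * (+ 2 * (+ 2 * + k + + 3) * c)
    ≡⟨ cong (- s * K * K * p′ *_) (halfCentral-suc k) ⟨
  - s * K * K * p′ * (+ suc (suc k) * c′)
    ≡⟨ lemma₅ K s p′ (+ suc (suc k)) c′ ⟩
  K * (K * (-[1+ 0 ] * s * + suc (suc k) * p′ * c′)) ∎))
  where
  open ≡-Reasoning
  K = + suc k
  s = sign k
  p = oddBinom x k
  p′ = oddBinom x (suc k)
  c = halfCentral k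
  c′ = halfCentral (suc k)
  lemma₁ : ∀ K x v′ v → K * (K * (x * v′)) ≡ x * (K * K * (v′ - v)) + K * K * (x * v)
  lemma₁ = solve-∀
  lemma₂ : ∀ K x v → x * (- (x * x) * v) + K * K * (x * v) ≡ (K * K - x * x) * (x * v)
  lemma₂ = solve-∀
  lemma₃ : ∀ K x s p c → (K * K - x * x) * (s * K * p * c) ≡ - s * K * c * ((x * x - K * K) * p)
  lemma₃ = solve-∀
  lemma₄ : ∀ K k s p c → - s * K * c * (+ 2 * K * (+ 2 * k + + 3) * p) ≡ - s * K * K * p * (+ 2 * (+ 2 * k + + 3) * c)
  lemma₄ = solve-∀
  lemma₅ : ∀ K s p L c → - s * K * K * p * (L * c) ≡ K * (K * (-[1+ 0 ] * s * L * p * c))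
  lemma₅ = solve-∀

-- One of the two factors k + 1 in `v-step` cancels against the one in `x*v`. The surviving x yields
-- the factor n in the sums divided by n.
v-increment : ∀ x k → + suc k * (v x (suc k) - v x k) ≡ - sign k * oddBinom x k * halfCentral k * x
v-increment x k = cancel-suc k (begin
  K * (K * (v x (suc k) - v x k))   ≡⟨ ℤP.*-assoc K K _ ⟨
  K * K * (v x (suc k) - v x k)     ≡⟨ v-step x k ⟩
  - (x * x) * v x k                 ≡⟨ lemma₁ x (v x k) ⟩
  - x * (x * v x k)                 ≡⟨ cong (- x *_) (x*v x k) ⟩
  - x * (s * K * p * c)             ≡⟨ lemma₂ K x s p c ⟩
  K * (- s * p * c * x)             ∎)
  where
  open ≡-Reasoning
  K = + suc k
  s = sign k
  p = oddBinom x k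
  c = halfCentral k
  lemma₁ : ∀ x v → - (x * x) * v ≡ - x * (x * v)
  lemma₁ = solve-∀
  lemma₂ : ∀ K x s p c → - x * (s * K * p * c) ≡ K * (- s * p * c * x)
  lemma₂ = solve-∀

halfCentral*x∣v-increment : ∀ x k → halfCentral k * x ∣ˢ + suc k * (v x (suc k) - v x k)
halfCentral*x∣v-increment x k = divides (- sign k * oddBinom x k)
  (trans (v-increment x k) (ℤP.*-assoc (- sign k * oddBinom x k) (halfCentral k) x))

-- The x of `v-increment` is given up in exchange for the remaining k + 1, through `suc∣x*oddBinom`.
halfCentral∣v-increment : ∀ x k → halfCentral k ∣ˢ v x (suc k) - v x k
halfCentral∣v-increment x k = divides (- sign k * e) (cancel-suc k (begin
  + suc k * (v x (suc k) - v x k)          ≡⟨ v-increment x k ⟩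
  - sign k * oddBinom x k * halfCentral k * x  ≡⟨ lemma₁ (sign k) (oddBinom x k) (halfCentral k) x ⟩
  - sign k * halfCentral k * (x * oddBinom x k) ≡⟨ cong (- sign k * halfCentral k *_) (ℤ∣._∣_.equality (suc∣x*oddBinom x k)) ⟩
  - sign k * halfCentral k * (e * + suc k)  ≡⟨ lemma₂ (sign k) e (halfCentral k) (+ suc k) ⟩
  + suc k * (- sign k * e * halfCentral k)  ∎))
  where
  open ≡-Reasoning
  e = ℤ∣.quotient (suc∣x*oddBinom x k)
  lemma₁ : ∀ s p c x → - s * p * c * x ≡ - s * c * (x * p)
  lemma₁ = solve-∀
  lemma₂ : ∀ s e c K → - s * c * (e * K) ≡ K * (- s * e * c)
  lemma₂ = solve-∀

-- An increment of u alone need not be divisible by C(2k + 1, k + 1). With the weight v it is: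
-- `u-step` brings out x, and x v contains (k + 1) C(2k + 1, k + 1).
halfCentral∣v*u-increment : ∀ x k → halfCentral k ∣ˢ v x k * (u x (suc k) - u x k)
halfCentral∣v*u-increment x k = divides (- (s * p * w)) (cancel-suc k (begin
  K * (v x k * (u x (suc k) - u x k))   ≡⟨ lemma₁ K (v x k) (u x (suc k) - u x k) ⟩
  v x k * (K * (u x (suc k) - u x k))   ≡⟨ cong (v x k *_) (u-step x k) ⟩
  v x k * (- x * w)                     ≡⟨ lemma₂ x (v x k) w ⟩
  - w * (x * v x k)                     ≡⟨ cong (- w *_) (x*v x k) ⟩
  - w * (s * K * p * c)                 ≡⟨ lemma₃ K w s p c ⟩
  K * (- (s * p * w) * c)               ∎))
  where
  open ≡-Reasoning
  K = + suc k
  s = sign k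
  p = oddBinom x k
  c = halfCentral k
  w = u x k
  lemma₁ : ∀ K v d → K * (v * d) ≡ v * (K * d)
  lemma₁ = solve-∀
  lemma₂ : ∀ x v w → v * (- x * w) ≡ - w * (x * v)
  lemma₂ = solve-∀
  lemma₃ : ∀ K w s p c → - w * (s * K * p * c) ≡ K * (- (s * p * w) * c)
  lemma₃ = solve-∀

v-even : ∀ x k → v (- x) k ≡ v x k
v-even x k = trans (cong (λ t → u (- x) k * u t k) (ℤP.neg-involutive x)) (ℤP.*-comm (u (- x) k) (u x k))

halfCentral∣v*u⁻-increment : ∀ x k → halfCentral k ∣ˢ v x k * (u (- x) (suc k) - u (- x) k)
halfCentral∣v*u⁻-increment x k =
  subst (λ t → halfCentral k ∣ˢ t * (u (- x) (suc k) - u (- x) k)) (v-even x k) (halfCentral∣v*u-increment (- x) k)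

monomial : ℤ → ℕ → ℕ → ℕ → ℤ
monomial x a b k = u x k ^ a * u (- x) k ^ b

-- Δ(v w) = Δv · w′ + v · Δw: the factor v split off from the product is the weight that makes v ·
-- Δw divisible. It exists because both exponents in the theorem are positive.
halfCentral∣monomial-increment : ∀ x a b k →
  halfCentral k ∣ˢ v x (suc k) * monomial x a b (suc k) - v x k * monomial x a b k
halfCentral∣monomial-increment x a b k =
  subst (halfCentral k ∣ˢ_) (lemma (v x k) (v x (suc k)) (monomial x a b k) (monomial x a b (suc k)))
    (ℤ∣.∣m∣n⇒∣m+n (ℤ∣.∣m⇒∣m*n (monomial x a b (suc k)) (halfCentral∣v-increment x k))
      (*-step-∣ (v x k) (u x k ^ a) (u x (suc k) ^ a) (u (- x) k ^ b) (u (- x) (suc k) ^ b)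
        (^-step-∣ (v x k) (u x k) (u x (suc k)) (halfCentral∣v*u-increment x k) a)
        (^-step-∣ (v x k) (u (- x) k) (u (- x) (suc k)) (halfCentral∣v*u⁻-increment x k) b)))
  where
  lemma : ∀ v v′ w w′ → (v′ - v) * w′ + v * (w′ - w) ≡ v′ * w′ - v * w
  lemma = solve-∀

-- At the last index x = k + 1, so the two cancel in `x*v`.
halfCentral∣v-last : ∀ n → halfCentral n ∣ˢ v (+ suc n) n
halfCentral∣v-last n = divides (sign n * oddBinom (+ suc n) n) (cancel-suc n
  (trans (x*v (+ suc n) n) (lemma (sign n) (+ suc n) (oddBinom (+ suc n) n) (halfCentral n))))
  where
  lemma : ∀ s n p c → s * n * p * c ≡ n * (s * p * c)
  lemma = solve-∀

-- Part (ii)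

-- Δ(p/q) = N/D, cleared of denominators.
record Antidifference (N D p q : ℕ → ℤ) : Set where
  field
    D≢0   : ∀ k → D k ≢ + 0
    q≢0   : ∀ k → q k ≢ + 0
    cross : ∀ k → (p (suc k) * q k - p k * q (suc k)) * D k ≡ N k * (q k * q (suc k))

-- The exponents of the two sequences u are a + 1 and b + 1; one factor v is kept apart as the
-- weight.
mixed : ℕ → ℕ → ℕ → ℕ → ℤ
mixed n a b k = v (+ suc n) k * monomial (+ suc n) a b k

∣-transfer : ∀ {c q} p y → q ∣ˢ p * c → c ∣ˢ y → q * + 1 ∣ˢ p * y
∣-transfer {c} {q} p y h (divides z e) = subst₂ _∣ˢ_ (sym (ℤP.*-identityʳ q))
  (trans (lemma z p c) (cong (p *_) (sym e))) (ℤ∣.∣n⇒∣m*n z h)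
  where
  lemma : ∀ z p c → z * (p * c) ≡ p * (z * c)
  lemma = solve-∀

integral-sum : ∀ {N D p q : ℕ → ℤ} → Antidifference N D p q → q 0 ∣ˢ p 0 → (∀ k → q (suc k) ∣ˢ p (suc k) * halfCentral k) →
  ∀ n a b → IsInt (sumℚ (suc n) (λ k → toℚ (N k * mixed n a b k) ÷ℤ D k))
integral-sum {N} {D} {p} {q} A first step n a b = isMultiple⇒isInt
  (Telescoping.isMultiple-sum p q N D (mixed n a b) (+ 1) D≢0 q≢0 cross
    (∣-transfer (p 0) (mixed n a b 0) (subst (q 0 ∣ˢ_) (sym (ℤP.*-identityʳ (p 0))) first) (divides (mixed n a b 0) (sym (ℤP.*-identityʳ _))))
    (λ k → ∣-transfer (p (suc k)) (mixed n a b (suc k) - mixed n a b k) (step k) (halfCentral∣monomial-increment (+ suc n) a b k))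
    n (∣-transfer (p (suc n)) (mixed n a b n) (step n) (ℤ∣.∣m⇒∣m*n (monomial (+ suc n) a b n) (halfCentral∣v-last n))))
  where open Antidifference A

∣-transfer-* : ∀ {c q x} k r y → q ∣ˢ r * c → c * x ∣ˢ k * y → q * x ∣ˢ k * r * y
∣-transfer-* {c} {q} {x} k r y h (divides z e) = subst (q * x ∣ˢ_)
  (trans (lemma₁ z r c x) (trans (cong (r *_) (sym e)) (lemma₂ k r y))) (ℤ∣.∣n⇒∣m*n z (ℤ∣.*-monoˡ-∣ x h))
  where
  lemma₁ : ∀ z r c x → z * (r * c * x) ≡ r * (z * (c * x))
  lemma₁ = solve-∀
  lemma₂ : ∀ k r y → r * (k * y) ≡ k * r * y
  lemma₂ = solve-∀

-- The factor k in the antidifference does two things: at k + 1 it turns the increments of v into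
-- multiples of C(2k + 1, k + 1) n, and at the upper end it equals n.
divided-sum : ∀ {N D} {r q : ℕ → ℤ} → Antidifference N D (λ k → + k * r k) q → (∀ k → q (suc k) ∣ˢ r (suc k) * halfCentral k) →
  ∀ n a → IsInt (sumℚ (suc n) (λ k → toℚ (N k * v (+ suc n) k ^ suc a) ÷ℤ D k) ÷ℤ + suc n)
divided-sum {N} {D} {r} {q} A step n a = isMultiple⇒isInt-÷ {+ suc n} (λ ())
  (Telescoping.isMultiple-sum (λ k → + k * r k) q N D y x D≢0 q≢0 cross
    (divides (+ 0) (lemma (r 0) (y 0) (q 0 * x)))
    (λ k → ∣-transfer-* (+ suc k) (r (suc k)) (y (suc k) - y k) (step k)
      (^-step-∣ (+ suc k) (v x k) (v x (suc k)) (halfCentral*x∣v-increment x k) (suc a)))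
    n (∣-transfer-* x (r (suc n)) (y n) (step n)
      (subst (_∣ˢ x * y n) (ℤP.*-comm x (halfCentral n)) (ℤ∣.*-monoʳ-∣ x (ℤ∣.∣m⇒∣m*n (v x n ^ a) (halfCentral∣v-last n))))))
  where
  open Antidifference A
  x = + suc n
  y : ℕ → ℤ
  y k = v x k ^ suc a
  lemma : ∀ r y d → + 0 * r * y ≡ + 0 * d
  lemma = solve-∀

-- The denominators of part (ii) and their antidifferences

*-≢0 : ∀ {x y} → x ≢ + 0 → y ≢ + 0 → x * y ≢ + 0
*-≢0 {x} x≢0 y≢0 e = [ x≢0 , y≢0 ]′ (ℤP.i*j≡0⇒i≡0∨j≡0 x e)

odd≢0 : ∀ k → + 1 + + 2 * + k ≢ + 0
odd≢0 k e with trans (cong (λ t → + 1 + t) (ℤP.pos-* 2 k)) e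
... | ()

D₁ D₂ D₃ : ℕ → ℤ
D₁ k = + 4 * (+ k) ^ 2 - + 1
D₂ k = binom (+ k + + 2) 2
D₃ k = (+ 2 * + k + + 1) * centralBinom k

q₁ q₂ : ℕ → ℤ
q₁ k = + 2 * + k - + 1
q₂ k = + suc k

q₁-suc : ∀ k → + 1 + + 2 * + k ≡ q₁ (suc k)
q₁-suc k = lemma (+ k)
  where
  lemma : ∀ k → + 1 + + 2 * k ≡ + 2 * (+ 1 + k) - + 1
  lemma = solve-∀

q₁≢0 : ∀ k → q₁ k ≢ + 0
q₁≢0 zero    ()
q₁≢0 (suc k) = subst (_≢ + 0) (q₁-suc k) (odd≢0 k)

D₁≢0 : ∀ k → D₁ k ≢ + 0
D₁≢0 k = subst (_≢ + 0) (lemma (+ k)) (*-≢0 (q₁≢0 k) (odd≢0 k))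
  where
  lemma : ∀ k → (+ 2 * k - + 1) * (+ 1 + + 2 * k) ≡ + 4 * (k * (k * + 1)) - + 1
  lemma = solve-∀

2*D₂ : ∀ k → D₂ k * + 2 ≡ + suc k * + suc (suc k)
2*D₂ k = trans (binom-! (+ k + + 2) 2) (lemma (+ k))
  where
  lemma : ∀ k → + 1 * (k + + 2 - + 0) * (k + + 2 - + 1) ≡ (+ 1 + k) * (+ 1 + (+ 1 + k))
  lemma = solve-∀

D₂≢0 : ∀ k → D₂ k ≢ + 0
D₂≢0 k e = *-≢0 {+ suc k} {+ suc (suc k)} (λ ()) (λ ()) (trans (sym (2*D₂ k)) (cong (_* + 2) e))

centralBinom≢0 : ∀ k → centralBinom k ≢ + 0
centralBinom≢0 zero    ()
centralBinom≢0 (suc k) e = *-≢0 (odd≢0 k) (centralBinom≢0 k)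
  (trans (sym (halfCentral-centralBinom k)) (trans (cong (+ suc k *_) c≡0) (ℤP.*-zeroʳ (+ suc k))))
  where
  c≡0 : halfCentral k ≡ + 0
  c≡0 = ℤP.*-cancelˡ-≡ (+ 2) (halfCentral k) (+ 0) (trans (sym (centralBinom-suc k)) e)

D₃≢0 : ∀ k → D₃ k ≢ + 0
D₃≢0 k = *-≢0 (subst (_≢ + 0) (ℤP.+-comm (+ 1) (+ 2 * + k)) (odd≢0 k)) (centralBinom≢0 k)

q₁∣ : ∀ r k → q₁ (suc k) ∣ˢ r * halfCentral k
q₁∣ r k = ℤ∣.∣n⇒∣m*n r (subst (_∣ˢ halfCentral k) (q₁-suc k) (odd∣halfCentral k))

q₂∣ : ∀ r k → q₂ (suc k) ∣ˢ + 2 * r * halfCentral k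
q₂∣ r k = subst (q₂ (suc k) ∣ˢ_) (lemma r (halfCentral k)) (ℤ∣.∣n⇒∣m*n r (suc-suc∣2*halfCentral k))
  where
  lemma : ∀ r c → r * (+ 2 * c) ≡ + 2 * r * c
  lemma = solve-∀

q₃∣ : ∀ r k → centralBinom (suc k) ∣ˢ + 2 * r * halfCentral k
q₃∣ r k = divides r (trans (lemma r (halfCentral k)) (cong (r *_) (sym (centralBinom-suc k))))
  where
  lemma : ∀ r c → + 2 * r * c ≡ r * (+ 2 * c)
  lemma = solve-∀

-- Partial fractions give -1/(2(2k - 1)). Adding the constant -1/2 makes it -k/(2k - 1), which
-- removes the 2 and creates the factor k needed for `divided-sum`.
antidifference₁ : Antidifference (λ _ → + 1) D₁ (λ k → + k * - + 1) q₁
antidifference₁ = record { D≢0 = D₁≢0 ; q≢0 = q₁≢0 ; cross = λ k → lemma (+ k) }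
  where
  lemma : ∀ k → ((+ 1 + k) * - + 1 * (+ 2 * k - + 1) - k * - + 1 * (+ 2 * (+ 1 + k) - + 1)) * (+ 4 * (k * (k * + 1)) - + 1)
              ≡ + 1 * ((+ 2 * k - + 1) * (+ 2 * (+ 1 + k) - + 1))
  lemma = solve-∀

-- Alternating the previous fraction replaces the difference by the sum (k + 1)/(2k + 1) + k/(2k -
-- 1) = 1 + 2k/(4k² - 1).
antidifference₁± : Antidifference (λ k → sign k * (+ 1 * D₁ k + + 2 * + k)) D₁ (λ k → + k * - sign k) q₁
antidifference₁± = record { D≢0 = D₁≢0 ; q≢0 = q₁≢0 ; cross = λ k → lemma (sign k) (+ k) }
  where
  lemma : ∀ s k → ((+ 1 + k) * - (-[1+ 0 ] * s) * (+ 2 * k - + 1) - k * - s * (+ 2 * (+ 1 + k) - + 1)) * (+ 4 * (k * (k * + 1)) - + 1)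
              ≡ s * (+ 1 * (+ 4 * (k * (k * + 1)) - + 1) + + 2 * k) * ((+ 2 * k - + 1) * (+ 2 * (+ 1 + k) - + 1))
  lemma = solve-∀

-- 1/(2k + 1) + 1/(2k - 1) = 4k/(4k² - 1); the 4 is removed later by parity.
antidifference₁±′ : Antidifference (λ k → + 4 * (sign k * + k)) D₁ (λ k → - sign k) q₁
antidifference₁±′ = record { D≢0 = D₁≢0 ; q≢0 = q₁≢0 ; cross = λ k → lemma (sign k) (+ k) }
  where
  lemma : ∀ s k → (- (-[1+ 0 ] * s) * (+ 2 * k - + 1) - - s * (+ 2 * (+ 1 + k) - + 1)) * (+ 4 * (k * (k * + 1)) - + 1)
              ≡ + 4 * (s * k) * ((+ 2 * k - + 1) * (+ 2 * (+ 1 + k) - + 1))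
  lemma = solve-∀

cross₂ : ∀ {E N} k → E ≡ N * + 2 → E * D₂ k ≡ N * (q₂ k * q₂ (suc k))
cross₂ {E} {N} k e = trans (cong (_* D₂ k) e) (trans (lemma N (D₂ k)) (cong (N *_) (2*D₂ k)))
  where
  lemma : ∀ N D → N * + 2 * D ≡ N * (D * + 2)
  lemma = solve-∀

-- The fraction -2/(k + 1) shifted by the constant 2 is 2k/(k + 1), again with a factor k.
antidifference₂ : Antidifference (λ _ → + 1) D₂ (λ k → + k * (+ 2 * + 1)) q₂
antidifference₂ = record { D≢0 = D₂≢0 ; q≢0 = λ _ () ; cross = λ k → cross₂ {N = + 1} k (lemma (+ k)) }
  where
  lemma : ∀ k → (+ 1 + k) * (+ 2 * + 1) * (+ 1 + k) - k * (+ 2 * + 1) * (+ 1 + (+ 1 + k)) ≡ + 1 * + 2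
  lemma = solve-∀

-- 2(k + 1)/(k + 2) + 2k/(k + 1) = 4 - 2/(k + 2) - 2/(k + 1), and the last two fractions combine to
-- (2k + 3) over C(k + 2, 2).
antidifference₂± : Antidifference (λ k → sign k * (+ 4 * D₂ k + - (+ 2 * + k + + 3))) D₂ (λ k → + k * (+ 2 * - sign k)) q₂
antidifference₂± = record { D≢0 = D₂≢0 ; q≢0 = λ _ () ; cross = λ k → cross₂ {N = sign k * (+ 4 * D₂ k + - (+ 2 * + k + + 3))} k
  (trans (lemma₁ (sign k) (+ k)) (trans (cong (λ t → sign k * (+ 4 * t - + 2 * (+ 2 * + k + + 3))) (sym (2*D₂ k))) (lemma₂ (sign k) (D₂ k) (+ k)))) }
  where
  lemma₁ : ∀ s k → (+ 1 + k) * (+ 2 * - (-[1+ 0 ] * s)) * (+ 1 + k) - k * (+ 2 * - s) * (+ 1 + (+ 1 + k))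
                 ≡ s * (+ 4 * ((+ 1 + k) * (+ 1 + (+ 1 + k))) - + 2 * (+ 2 * k + + 3))
  lemma₁ = solve-∀
  lemma₂ : ∀ s D k → s * (+ 4 * (D * + 2) - + 2 * (+ 2 * k + + 3)) ≡ s * (+ 4 * D + - (+ 2 * k + + 3)) * + 2
  lemma₂ = solve-∀

antidifference₂±′ : Antidifference (λ k → sign k * (+ 2 * + k + + 3)) D₂ (λ k → + 2 * - sign k) q₂
antidifference₂±′ = record { D≢0 = D₂≢0 ; q≢0 = λ _ () ; cross = λ k → cross₂ {N = sign k * (+ 2 * + k + + 3)} k (lemma (sign k) (+ k)) }
  where
  lemma : ∀ s k → + 2 * - (-[1+ 0 ] * s) * (+ 1 + k) - + 2 * - s * (+ 1 + (+ 1 + k)) ≡ s * (+ 2 * k + + 3) * + 2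
  lemma = solve-∀

-- The ratio C(2k + 2, k + 1)/C(2k, k) is 2(2k + 1)/(k + 1), so -2/C(2k, k) has the numerator 2(2k +
-- 1) - (k + 1) = 3k + 1. In the alternating version the minus becomes a plus and gives 5k + 3.
antidifference₃ : Antidifference (λ k → + 3 * + k + + 1) D₃ (λ k → + 2 * - + 1) centralBinom
antidifference₃ = record { D≢0 = D₃≢0 ; q≢0 = centralBinom≢0 ; cross = λ k →
  trans (cong (λ t → (+ 2 * - + 1 * centralBinom k - + 2 * - + 1 * t) * D₃ k) (centralBinom-suc k))
    (trans (lemma₁ (+ k) (centralBinom k) (halfCentral k))
    (trans (cong (λ t → - + 2 * centralBinom k * t + + 4 * halfCentral k * D₃ k) (sym (halfCentral-centralBinom k)))
    (trans (lemma₂ (+ k) (centralBinom k) (halfCentral k))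
      (cong (λ t → (+ 3 * + k + + 1) * (centralBinom k * t)) (sym (centralBinom-suc k)))))) }
  where
  lemma₁ : ∀ k C c → (+ 2 * - + 1 * C - + 2 * - + 1 * (+ 2 * c)) * ((+ 2 * k + + 1) * C)
                   ≡ - + 2 * C * ((+ 1 + + 2 * k) * C) + + 4 * c * ((+ 2 * k + + 1) * C)
  lemma₁ = solve-∀
  lemma₂ : ∀ k C c → - + 2 * C * ((+ 1 + k) * c) + + 4 * c * ((+ 2 * k + + 1) * C) ≡ (+ 3 * k + + 1) * (C * (+ 2 * c))
  lemma₂ = solve-∀

antidifference₃± : Antidifference (λ k → sign k * (+ 5 * + k + + 3)) D₃ (λ k → + 2 * - sign k) centralBinom
antidifference₃± = record { D≢0 = D₃≢0 ; q≢0 = centralBinom≢0 ; cross = λ k →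
  trans (cong (λ t → (+ 2 * - sign (suc k) * centralBinom k - + 2 * - sign k * t) * D₃ k) (centralBinom-suc k))
    (trans (lemma₁ (sign k) (+ k) (centralBinom k) (halfCentral k))
    (trans (cong (λ t → + 2 * sign k * centralBinom k * t + + 4 * sign k * halfCentral k * D₃ k) (sym (halfCentral-centralBinom k)))
    (trans (lemma₂ (sign k) (+ k) (centralBinom k) (halfCentral k))
      (cong (λ t → sign k * (+ 5 * + k + + 3) * (centralBinom k * t)) (sym (centralBinom-suc k)))))) }
  where
  lemma₁ : ∀ s k C c → (+ 2 * - (-[1+ 0 ] * s) * C - + 2 * - s * (+ 2 * c)) * ((+ 2 * k + + 1) * C)
                     ≡ + 2 * s * C * ((+ 1 + + 2 * k) * C) + + 4 * s * c * ((+ 2 * k + + 1) * C)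
  lemma₁ = solve-∀
  lemma₂ : ∀ s k C c → + 2 * s * C * ((+ 1 + k) * c) + + 4 * s * c * ((+ 2 * k + + 1) * C) ≡ s * (+ 5 * k + + 3) * (C * (+ 2 * c))
  lemma₂ = solve-∀

-- Serves to divide by 4: a rational with odd denominator whose fourfold is an integer is itself an
-- integer.
OddDenominator : ℚ → Set
OddDenominator x = ∃₂ λ j z → x Q.* toℚ (+ 2 * j + + 1) ≡ toℚ z

oddDenominator-+ : ∀ x y → OddDenominator x → OddDenominator y → OddDenominator (x Q.+ y)
oddDenominator-+ x y (i , z , e) (j , w , f) = + 2 * i * j + i + j , z * d + w * c , (begin
  (x Q.+ y) Q.* toℚ (+ 2 * (+ 2 * i * j + i + j) + + 1)
    ≡⟨ cong (λ t → (x Q.+ y) Q.* t) (trans (cong toℚ (lemma i j)) (toℚ-* c d)) ⟩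
  (x Q.+ y) Q.* (toℚ c Q.* toℚ d)
    ≡⟨ solve 4 (λ x y c d → (x :+ y) :* (c :* d) := x :* c :* d :+ y :* d :* c) refl x y (toℚ c) (toℚ d) ⟩
  x Q.* toℚ c Q.* toℚ d Q.+ y Q.* toℚ d Q.* toℚ c
    ≡⟨ cong₂ (λ s t → s Q.* toℚ d Q.+ t Q.* toℚ c) e f ⟩
  toℚ z Q.* toℚ d Q.+ toℚ w Q.* toℚ c
    ≡⟨ cong₂ Q._+_ (toℚ-* z d) (toℚ-* w c) ⟨
  toℚ (z * d) Q.+ toℚ (w * c)
    ≡⟨ toℚ-+ (z * d) (w * c) ⟨
  toℚ (z * d + w * c) ∎)
  where
  open ≡-Reasoning
  open +-*-Solver using (solve; _:*_; _:+_; _:=_)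
  c = + 2 * i + + 1
  d = + 2 * j + + 1
  lemma : ∀ i j → + 2 * (+ 2 * i * j + i + j) + + 1 ≡ (+ 2 * i + + 1) * (+ 2 * j + + 1)
  lemma = solve-∀

oddDenominator-sum : ∀ n (f : ℕ → ℚ) → (∀ k → OddDenominator (f k)) → OddDenominator (sumℚ n f)
oddDenominator-sum zero    f h = + 0 , + 0 , refl
oddDenominator-sum (suc n) f h = oddDenominator-+ (sumℚ n f) (f n) (oddDenominator-sum n f h) (h n)

oddDenominator-÷D₁ : ∀ t k → OddDenominator (toℚ t ÷ℤ D₁ k)
oddDenominator-÷D₁ t k = + 2 * + k * + k - + 1 , t , (begin
  toℚ t ÷ℤ D₁ k Q.* toℚ (+ 2 * (+ 2 * + k * + k - + 1) + + 1)
    ≡⟨ cong₂ Q._*_ (÷ℤ-inv (toℚ t) (D₁ k)) (cong toℚ (lemma (+ k))) ⟩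
  toℚ t Q.* inv (D₁ k) Q.* toℚ (D₁ k)
    ≡⟨ ℚP.*-assoc (toℚ t) (inv (D₁ k)) (toℚ (D₁ k)) ⟩
  toℚ t Q.* (inv (D₁ k) Q.* toℚ (D₁ k))
    ≡⟨ trans (cong (toℚ t Q.*_) (inv-inverseˡ (D₁ k) (D₁≢0 k))) (ℚP.*-identityʳ (toℚ t)) ⟩
  toℚ t ∎)
  where
  open ≡-Reasoning
  lemma : ∀ k → + 2 * (+ 2 * k * k - + 1) + + 1 ≡ + 4 * (k * (k * + 1)) - + 1
  lemma = solve-∀

-- (2j + 1)² − 4 (j² + j) = 1
isInt-from-4 : ∀ x → OddDenominator x → IsInt (toℚ (+ 4) Q.* x) → IsInt x
isInt-from-4 x (j , z , e) (w , f) = z * d - w * (j * j + j) , (begin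
  x
    ≡⟨ ℚP.*-identityʳ x ⟨
  x Q.* 1ℚ
    ≡⟨ cong (x Q.*_) (trans (cong toℚ (lemma j)) (trans (toℚ-- (d * d) (+ 4 * (j * j + j))) (cong₂ Q._-_ (toℚ-* d d) (toℚ-* (+ 4) (j * j + j))))) ⟩
  x Q.* (toℚ d Q.* toℚ d Q.- toℚ (+ 4) Q.* toℚ (j * j + j))
    ≡⟨ solve 4 (λ x d f i → x :* (d :* d :- f :* i) := x :* d :* d :- f :* x :* i) refl x (toℚ d) (toℚ (+ 4)) (toℚ (j * j + j)) ⟩
  x Q.* toℚ d Q.* toℚ d Q.- toℚ (+ 4) Q.* x Q.* toℚ (j * j + j)
    ≡⟨ cong₂ (λ s t → s Q.* toℚ d Q.- t Q.* toℚ (j * j + j)) e f ⟩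
  toℚ z Q.* toℚ d Q.- toℚ w Q.* toℚ (j * j + j)
    ≡⟨ cong₂ Q._-_ (toℚ-* z d) (toℚ-* w (j * j + j)) ⟨
  toℚ (z * d) Q.- toℚ (w * (j * j + j))
    ≡⟨ toℚ-- (z * d) (w * (j * j + j)) ⟨
  toℚ (z * d - w * (j * j + j)) ∎)
  where
  open ≡-Reasoning
  open +-*-Solver using (solve; _:*_; _:-_; _:=_)
  d = + 2 * j + + 1
  lemma : ∀ j → + 1 ≡ (+ 2 * j + + 1) * (+ 2 * j + + 1) - + 4 * (j * j + j)
  lemma = solve-∀

÷ℤ-scale : ∀ x y D → toℚ x Q.* (toℚ y ÷ℤ D) ≡ toℚ (x * y) ÷ℤ D
÷ℤ-scale x y D = begin
  toℚ x Q.* (toℚ y ÷ℤ D)          ≡⟨ cong (toℚ x Q.*_) (÷ℤ-inv (toℚ y) D) ⟩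
  toℚ x Q.* (toℚ y Q.* inv D)     ≡⟨ ℚP.*-assoc (toℚ x) (toℚ y) (inv D) ⟨
  toℚ x Q.* toℚ y Q.* inv D       ≡⟨ cong (Q._* inv D) (toℚ-* x y) ⟨
  toℚ (x * y) Q.* inv D           ≡⟨ ÷ℤ-inv (toℚ (x * y)) D ⟨
  toℚ (x * y) ÷ℤ D                ∎
  where open ≡-Reasoning

neg-÷ℤ : ∀ y D → Q.- (toℚ y ÷ℤ D) ≡ toℚ (- y) ÷ℤ D
neg-÷ℤ y D = begin
  Q.- (toℚ y ÷ℤ D)           ≡⟨ cong Q.-_ (÷ℤ-inv (toℚ y) D) ⟩
  Q.- (toℚ y Q.* inv D)      ≡⟨ ℚP.neg-distribˡ-* (toℚ y) (inv D) ⟩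
  Q.- toℚ y Q.* inv D        ≡⟨ cong (Q._* inv D) (toℚ-neg y) ⟨
  toℚ (- y) Q.* inv D        ≡⟨ ÷ℤ-inv (toℚ (- y)) D ⟨
  toℚ (- y) ÷ℤ D             ∎
  where open ≡-Reasoning

-- The ten sums of part (ii) for fixed exponents

module FixedExponents (a′ b′ n′ : ℕ) where
  a b : ℕ
  a = suc a′
  b = suc b′
  n : ℤ
  n = + suc n′

  B C S T y : ℕ → ℤ
  B k = binom (n - + 1) k
  C k = binom (- n - + 1) k
  S k = B k ^ a * C k ^ a
  T k = B k ^ a * C k ^ b
  y = mixed n′ a′ b′

  sg : ℕ → ℕ → ℤ
  sg e k = -[1+ 0 ] ^ (e N.* k)

  sg-sign : ∀ e k → sg e k ≡ sign k ^ e
  sg-sign e k = trans (cong sign (ℕP.*-comm e k)) (sym (ℤP.^-*-assoc -[1+ 0 ] k e))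

  S-v : ∀ k → S k ≡ v n k ^ a
  S-v k = trans (sym (^-distribʳ-* (B k) (C k) a)) (cong (_^ a) (sym (v-binom n k)))

  y-T : ∀ k → y k ≡ sign k ^ a * sign k ^ b * T k
  y-T k = begin
    u n k * u (- n) k * (u n k ^ a′ * u (- n) k ^ b′)    ≡⟨ lemma (u n k) (u (- n) k) (u n k ^ a′) (u (- n) k ^ b′) ⟩
    u n k ^ a * u (- n) k ^ b                            ≡⟨ cong₂ _*_ (^-distribʳ-* (sign k) (B k) a) (^-distribʳ-* (sign k) (C k) b) ⟩
    sign k ^ a * B k ^ a * (sign k ^ b * C k ^ b)        ≡⟨ lemma (sign k ^ a) (B k ^ a) (sign k ^ b) (C k ^ b) ⟩
    sign k ^ a * sign k ^ b * (B k ^ a * C k ^ b)        ∎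
    where
    open ≡-Reasoning
    lemma : ∀ a b c d → a * b * (c * d) ≡ a * c * (b * d)
    lemma = solve-∀

  sg-T : ∀ k → sg (a N.+ b) k * T k ≡ y k
  sg-T k = trans (cong (_* T k) (trans (sg-sign (a N.+ b) k) (ℤP.^-distribˡ-+-* (sign k) a b))) (sym (y-T k))

  -- Lowering the exponent a + b by one amounts to one more factor (-1)^k, because its square is 1.
  sg-T′ : ∀ k → sg (a N.+ b N.∸ 1) k * T k ≡ sign k * y k
  sg-T′ k = begin
    sg (a′ N.+ b) k * T k                               ≡⟨ cong (_* T k) (trans (sg-sign (a′ N.+ b) k) (ℤP.^-distribˡ-+-* (sign k) a′ b)) ⟩
    s ^ a′ * s ^ b * T k                                ≡⟨ ℤP.*-identityˡ _ ⟨
    + 1 * (s ^ a′ * s ^ b * T k)                        ≡⟨ cong (_* (s ^ a′ * s ^ b * T k)) (sign² k) ⟨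
    s * s * (s ^ a′ * s ^ b * T k)                      ≡⟨ lemma s (s ^ a′) (s ^ b) (T k) ⟩
    s * (s * s ^ a′ * s ^ b * T k)                      ≡⟨ cong (s *_) (y-T k) ⟨
    s * y k                                             ∎
    where
    open ≡-Reasoning
    s = sign k
    lemma : ∀ s p q t → s * s * (p * q * t) ≡ s * (s * p * q * t)
    lemma = solve-∀

  1*S : ∀ k → + 1 * v n k ^ a ≡ S k
  1*S k = trans (ℤP.*-identityˡ _) (sym (S-v k))

  1*y : ∀ k → + 1 * y k ≡ sg (a N.+ b) k * T k
  1*y k = trans (ℤP.*-identityˡ _) (sym (sg-T k))

  weight-y : ∀ w k → w * y k ≡ sg (a N.+ b) k * w * T k
  weight-y w k = trans (cong (w *_) (sym (sg-T k))) (lemma w (sg (a N.+ b) k) (T k))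
    where
    lemma : ∀ w g t → w * (g * t) ≡ g * w * t
    lemma = solve-∀

  weight-sign-y : ∀ w k → sign k * w * y k ≡ sg (a N.+ b N.∸ 1) k * w * T k
  weight-sign-y w k = trans (lemma₁ (sign k) w (y k)) (trans (cong (w *_) (sym (sg-T′ k))) (lemma₂ w (sg (a N.+ b N.∸ 1) k) (T k)))
    where
    lemma₁ : ∀ s w y → s * w * y ≡ w * (s * y)
    lemma₁ = solve-∀
    lemma₂ : ∀ w g t → w * (g * t) ≡ g * w * t
    lemma₂ = solve-∀

  rewrite-sum : ∀ {N M D : ℕ → ℤ} → (∀ k → N k ≡ M k) →
    sumℚ (suc n′) (λ k → toℚ (N k) ÷ℤ D k) ≡ sumℚ (suc n′) (λ k → toℚ (M k) ÷ℤ D k)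
  rewrite-sum {D = D} e = sumℚ-cong (suc n′) (λ k → cong (λ t → toℚ t ÷ℤ D k) (e k))

  sum-S/D₁ : IsInt (sumℚ (suc n′) (λ k → toℚ (S k) ÷ℤ D₁ k) ÷ℤ n)
  sum-S/D₁ = subst (λ t → IsInt (t ÷ℤ n)) (rewrite-sum {D = D₁} 1*S)
    (divided-sum antidifference₁ (λ k → q₁∣ (- + 1) k) n′ a′)

  sum-S/D₂ : IsInt (sumℚ (suc n′) (λ k → toℚ (S k) ÷ℤ D₂ k) ÷ℤ n)
  sum-S/D₂ = subst (λ t → IsInt (t ÷ℤ n)) (rewrite-sum {D = D₂} 1*S)
    (divided-sum antidifference₂ (λ k → q₂∣ (+ 1) k) n′ a′)

  combine : ∀ x w D k → D ≢ + 0 →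
    toℚ (sign k * (x * D + w) * v n k ^ a) ÷ℤ D ≡ toℚ (sg 1 k * S k) Q.* (toℚ x Q.+ toℚ w ÷ℤ D)
  combine x w D k D≢0 = begin
    toℚ (sign k * (x * D + w) * v n k ^ a) ÷ℤ D
      ≡⟨ cong (λ t → toℚ t ÷ℤ D) (lemma (sign k) (x * D + w) (v n k ^ a)) ⟩
    toℚ (sign k * v n k ^ a * (x * D + w)) ÷ℤ D
      ≡⟨ cong₂ (λ s t → toℚ (s * t * (x * D + w)) ÷ℤ D) (cong sign (sym (ℕP.+-identityʳ k))) (sym (S-v k)) ⟩
    toℚ (sg 1 k * S k * (x * D + w)) ÷ℤ D
      ≡⟨ ÷ℤ-combine x w (sg 1 k * S k) D D≢0 ⟨
    toℚ (sg 1 k * S k) Q.* (toℚ x Q.+ toℚ w ÷ℤ D) ∎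
    where
    open ≡-Reasoning
    lemma : ∀ s w v → s * w * v ≡ s * v * w
    lemma = solve-∀

  alternatingSum-S/D₁ : IsInt (sumℚ (suc n′) (λ k → toℚ (sg 1 k * S k) Q.* (toℚ (+ 1) Q.+ toℚ (+ 2 * + k) ÷ℤ D₁ k)) ÷ℤ n)
  alternatingSum-S/D₁ = subst (λ t → IsInt (t ÷ℤ n)) (sumℚ-cong (suc n′) (λ k → combine (+ 1) (+ 2 * + k) (D₁ k) k (D₁≢0 k)))
    (divided-sum antidifference₁± (λ k → q₁∣ (- sign (suc k)) k) n′ a′)

  alternatingSum-S/D₂ : IsInt (sumℚ (suc n′) (λ k → toℚ (sg 1 k * S k) Q.* (toℚ (+ 4) Q.- toℚ (+ 2 * + k + + 3) ÷ℤ D₂ k)) ÷ℤ n)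
  alternatingSum-S/D₂ = subst (λ t → IsInt (t ÷ℤ n))
    (sumℚ-cong (suc n′) (λ k → trans (combine (+ 4) (- (+ 2 * + k + + 3)) (D₂ k) k (D₂≢0 k))
      (cong (λ t → toℚ (sg 1 k * S k) Q.* (toℚ (+ 4) Q.+ t)) (sym (neg-÷ℤ (+ 2 * + k + + 3) (D₂ k))))))
    (divided-sum antidifference₂± (λ k → q₂∣ (- sign (suc k)) k) n′ a′)

  sum-T/D₁ : IsInt (sumℚ (suc n′) (λ k → toℚ (sg (a N.+ b) k * T k) ÷ℤ D₁ k))
  sum-T/D₁ = subst IsInt (rewrite-sum {D = D₁} 1*y)
    (integral-sum antidifference₁ (divides (+ 0) refl) (λ k → q₁∣ (+ suc k * - + 1) k) n′ a′ b′)

  alternatingSum-T/D₁ : IsInt (sumℚ (suc n′) (λ k → toℚ (sg (a N.+ b N.∸ 1) k * + k * T k) ÷ℤ D₁ k))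
  alternatingSum-T/D₁ = isInt-from-4 (sumℚ (suc n′) f) (oddDenominator-sum (suc n′) f (λ k → oddDenominator-÷D₁ (sg (a N.+ b N.∸ 1) k * + k * T k) k))
    (subst IsInt (trans (sumℚ-cong (suc n′) eq) (sumℚ-*ˡ (suc n′) (toℚ (+ 4)) f))
      (integral-sum antidifference₁±′ (divides (+ 1) refl) (λ k → q₁∣ (- sign (suc k)) k) n′ a′ b′))
    where
    f : ℕ → ℚ
    f k = toℚ (sg (a N.+ b N.∸ 1) k * + k * T k) ÷ℤ D₁ k
    eq : ∀ k → toℚ (+ 4 * (sign k * + k) * y k) ÷ℤ D₁ k ≡ toℚ (+ 4) Q.* f k
    eq k = trans (cong (λ t → toℚ t ÷ℤ D₁ k) (trans (ℤP.*-assoc (+ 4) (sign k * + k) (y k)) (cong (+ 4 *_) (weight-sign-y (+ k) k))))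
      (sym (÷ℤ-scale (+ 4) (sg (a N.+ b N.∸ 1) k * + k * T k) (D₁ k)))

  sum-T/D₂ : IsInt (sumℚ (suc n′) (λ k → toℚ (sg (a N.+ b) k * T k) ÷ℤ D₂ k))
  sum-T/D₂ = subst IsInt (rewrite-sum {D = D₂} 1*y)
    (integral-sum antidifference₂ (divides (+ 0) refl)
      (λ k → subst (λ t → q₂ (suc k) ∣ˢ t * halfCentral k) (ℤP.*-comm (+ 2 * + 1) (+ suc k)) (q₂∣ (+ suc k) k)) n′ a′ b′)

  alternatingSum-T/D₂ : IsInt (sumℚ (suc n′) (λ k → toℚ (sg (a N.+ b N.∸ 1) k * (+ 2 * + k + + 3) * T k) ÷ℤ D₂ k))
  alternatingSum-T/D₂ = subst IsInt (rewrite-sum {D = D₂} (λ k → weight-sign-y (+ 2 * + k + + 3) k))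
    (integral-sum antidifference₂±′ (divides (- + 2) refl) (λ k → q₂∣ (- sign (suc k)) k) n′ a′ b′)

  sum-T/D₃ : IsInt (sumℚ (suc n′) (λ k → toℚ (sg (a N.+ b) k * (+ 3 * + k + + 1) * T k) ÷ℤ D₃ k))
  sum-T/D₃ = subst IsInt (rewrite-sum {D = D₃} (λ k → weight-y (+ 3 * + k + + 1) k))
    (integral-sum antidifference₃ (divides (- + 2) refl) (λ k → q₃∣ (- + 1) k) n′ a′ b′)

  alternatingSum-T/D₃ : IsInt (sumℚ (suc n′) (λ k → toℚ (sg (a N.+ b N.∸ 1) k * (+ 5 * + k + + 3) * T k) ÷ℤ D₃ k))
  alternatingSum-T/D₃ = subst IsInt (rewrite-sum {D = D₃} (λ k → weight-sign-y (+ 5 * + k + + 3) k))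
    (integral-sum antidifference₃± (divides (- + 2) refl) (λ k → q₃∣ (- sign (suc k)) k) n′ a′ b′)

theorem1p5 :
  -- part (i)
  ((m : ℕ) → 1 ≤ m → (a : Fin m → ℤ) → (n : ℕ) → 0 < n →
    let P : ℕ → ℤ
        P k = prodFin m (λ i → binom (a i * + n - + 1) k)
        R : ℕ → ℤ
        R k = prodFin m (λ i → binom (a i * + n - + 1) k * binom (- (a i * + n) - + 1) k)
        g : ℤ
        g = gcd (sumFin m a - + 1) (+ 2)
    in ((ε : ℤ) → (ε ≡ + 1 ⊎ ε ≡ -[1+ 0 ]) →
          (+ n ∣ sumℤ n (λ k → ε ^ k * (+ 2 * + k + + 1) * P k))
        × (+ n ∣ sumℤ n (λ k → ε ^ k * (+ 4 * (+ k) ^ 3 - + 1) * P k)))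
     × ((+ n) ^ 2 ∣ g * sumℤ n (λ k → -[1+ 0 ] ^ (k N.* m) * (+ 2 * + k + + 1) * P k))
     × ((+ n) ^ 2 ∣ + 6 * sumℤ n (λ k → -[1+ 0 ] ^ (k N.* m)
                                       * (+ 3 * (+ k) ^ 2 + + 3 * + k + + 1) * P k))
     × ((+ n) ^ 2 ∣ sumℤ n (λ k → -[1+ 0 ] ^ k * (+ 4 * (+ k) ^ 3 - + 1) * R k))
     × ((+ n) ^ 3 ∣ g * sumℤ n (λ k → (+ 3 * (+ k) ^ 2 + + 3 * + k + + 1) * R k)))
  ×
  -- part (ii)
  ((a b n : ℕ) → 0 < a → 0 < b → 0 < n →
    let B : ℕ → ℤ
        B k = binom (+ n - + 1) k
        C : ℕ → ℤ
        C k = binom (- (+ n) - + 1) k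
        S : ℕ → ℤ
        S k = B k ^ a * C k ^ a
        T : ℕ → ℤ
        T k = B k ^ a * C k ^ b
        D₁ : ℕ → ℤ
        D₁ k = + 4 * (+ k) ^ 2 - + 1
        D₂ : ℕ → ℤ
        D₂ k = binom (+ k + + 2) 2
        D₃ : ℕ → ℤ
        D₃ k = (+ 2 * + k + + 1) * binom (+ 2 * + k) k
        sg : ℕ → ℕ → ℤ
        sg e k = -[1+ 0 ] ^ (e N.* k)
    in IsInt (sumℚ n (λ k → toℚ (S k) ÷ℤ D₁ k) ÷ℤ (+ n))
     × IsInt (sumℚ n (λ k → toℚ (S k) ÷ℤ D₂ k) ÷ℤ (+ n))
     × IsInt (sumℚ n (λ k → toℚ (sg 1 k * S k)
                  Q.* (toℚ (+ 1) Q.+ toℚ (+ 2 * + k) ÷ℤ D₁ k)) ÷ℤ (+ n))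
     × IsInt (sumℚ n (λ k → toℚ (sg 1 k * S k)
                  Q.* (toℚ (+ 4) Q.- toℚ (+ 2 * + k + + 3) ÷ℤ D₂ k)) ÷ℤ (+ n))
     × IsInt (sumℚ n (λ k → toℚ (sg (a N.+ b) k * T k) ÷ℤ D₁ k))
     × IsInt (sumℚ n (λ k → toℚ (sg (a N.+ b ∸ 1) k * + k * T k) ÷ℤ D₁ k))
     × IsInt (sumℚ n (λ k → toℚ (sg (a N.+ b) k * T k) ÷ℤ D₂ k))
     × IsInt (sumℚ n (λ k → toℚ (sg (a N.+ b ∸ 1) k * (+ 2 * + k + + 3) * T k) ÷ℤ D₂ k))
     × IsInt (sumℚ n (λ k → toℚ (sg (a N.+ b) k * (+ 3 * + k + + 1) * T k) ÷ℤ D₃ k))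
     × IsInt (sumℚ n (λ k → toℚ (sg (a N.+ b ∸ 1) k * (+ 5 * + k + + 3) * T k) ÷ℤ D₃ k)))
theorem1p5 =
  (λ { m _ a zero () ; m _ a (suc n′) _ →
    let open FixedModulus m a n′ in
    (λ ε ε=±1 → ℤ∣.∣⇒∣ᵤ (unit-sum-w₁-P ε ε=±1) , ℤ∣.∣⇒∣ᵤ (unit-sum-w₃-P ε ε=±1)) ,
    ℤ∣.∣⇒∣ᵤ sum-w₁-P , ℤ∣.∣⇒∣ᵤ sum-w₂-P , ℤ∣.∣⇒∣ᵤ sum-w₃-R , ℤ∣.∣⇒∣ᵤ sum-w₂-R }) ,
  (λ { zero _ _ () _ _ ; (suc _) zero _ _ () _ ; (suc _) (suc _) zero _ _ () ; (suc a′) (suc b′) (suc n′) _ _ _ →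
    let open FixedExponents a′ b′ n′ in
    sum-S/D₁ , sum-S/D₂ , alternatingSum-S/D₁ , alternatingSum-S/D₂ , sum-T/D₁ , alternatingSum-T/D₁ ,
    sum-T/D₂ , alternatingSum-T/D₂ , sum-T/D₃ , alternatingSum-T/D₃ })
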